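{- Let $k=2K+1$ be an odd integer, and let $\mathcal{B}_K^{(1)}$ be the $(K-1)\times(K-1)$ submatrix of $\mathcal{B}_K$ obtained by deleting the last column and the last row of $\mathcal{B}_K$. Then the vectors formed by the coefficients of $Z_{r,s}$ in the weight-$k$ Type I and Type II relations belong to the left kernel of $\mathcal{B}_K^{(1)}$. Explicitly: (Type I) if $2K\ge 12$ and $p\in W_{2K}^+$, with $b_{r,s}$ ($r+s=2K+1$, $r,s\ge1$) defined by $p(X+Y,Y)=\sum_{r+s=2K+1}\binom{2K-1}{r-1}b_{r,s}X^{r-1}Y^{s-2}$ (so $b_{2K,1}=0$), then the row vector $v=(v_1,\dots,v_{K-1})$ with $v_1=0$ and $v_i=b_{2i,\,k-2i}-b_{k-2i,\,2i}$ for $2\le i\le K-1$ satisfies $v\,\mathcal{B}_K^{(1)}=0$; (Type II) if $2K+2\ge 12$ and $p\in W_{2K+2}^-$, with $c_{r,s}$ ($r+s=2K+1$, $r,s\ge1$) defined by $\frac{\partial}{\partial X}p(X+Y,Y)=\sum_{r+s=2K+1}\binom{2K-1}{r-1}c_{r,s}X^{r-1}Y^{s-1}$, then the row vector $v=(v_1,\dots,v_{K-1})$ with $v_1=0$ and $v_i=c_{2i,\,k-2i}-c_{k-2i,\,2i}$ for $2\le i\le K-1$ satisfies $v\,\mathcal{B}_K^{(1)}=0$.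
   Context: The matrix $\mathcal{B}_K$. For $k=2K+1$, Zagier's formula states, for $0\le m\le K-1$, $$\zeta(k-2m-1,2m+1)=\sum_{n=1}^K\left[\delta_{n,m}+\delta_{n,K}-\binom{2n}{2m}-\binom{2n}{2K-2m-1}\right]\zeta(2n+1)\zeta(k-2n-1),$$ with the convention $\zeta(0)=-\tfrac12$, where $\zeta(r,s)=\sum_{a>b>0}a^{ -r}b^{ -s}$ and $\delta$ is the Kronecker delta. $\mathcal{B}_K$ is the $K\times K$ matrix expressing the column vector $(\zeta(2,k-2),\zeta(4,k-4),\dots,\zeta(2K,1))^T$ in terms of the column vector $(\zeta(k-3)\zeta(3),\zeta(k-5)\zeta(5),\dots,\zeta(2)\zeta(k-2),\zeta(k))^T$ via this formula: row $i$ ($1\le i\le K$) corresponds to $\zeta(2i,k-2i)$, i.e. $m=K-i$; column $n$ ($1\le n\le K-1$) corresponds to $\zeta(2n+1)\zeta(k-2n-1)$; the last column $n=K$ corresponds to $\zeta(k)$ (the factor $\zeta(0)=-\frac12$ being absorbed into the entries). Hence the entries of $\mathcal{B}_K^{(1)}$ are, for $1\le i,n\le K-1$, $$(\mathcal{B}_K^{(1)})_{i,n}=\delta_{n,K-i}-\binom{2n}{2K-2i}-\binom{2n}{2i-1}.$$ Binomial coefficients $\binom{a}{b}$ with $b>a\ge0$ are $0$. The left kernel of a matrix $M$ is the space of row vectors $v$ with $vM=0$. The Type I and Type II relations of weight $k$ are the relations $\sum (b_{r,s}-b_{s,r})Z_{r,s}\equiv 0$ and $\sum(c_{r,s}-c_{s,r})Z_{r,s}\equiv0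 \pmod {Z_k}$, summed over even $r$ with $4\le r\le k-3$ and $s=k-r$, in the formal double zeta space of weight $k$ (with formal symbols $Z_{r,s}$ corresponding to $\zeta(r,s)$); only their coefficients matter here. Period polynomials. For even $w$, $W_w$ is the space of homogeneous polynomials $P\in\mathbb{Q}[X,Y]$ of degree $w-2$ satisfying $P(X,Y)+P(-Y,X)=0$ and $P(X,Y)+P(X-Y,X)+P(Y,Y-X)=0$; $W_w^+$ (resp. $W_w^-$) is the subspace of those that are symmetric, $P(X,Y)=P(Y,X)$ (resp. antisymmetric, $P(X,Y)=-P(Y,X)$). -}

module Defs where

open import Data.Bool.Base using (if_then_else_)
open import Data.Fin.Base using (Fin; zero; suc; toℕ)
import Data.Integer.Base as ℤ
open import Data.List.Base using (List; []; _∷_; _++_; map; upTo; cartesianProductWith)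
open import Data.Nat as ℕ using (ℕ; zero; suc; _∸_; _≟_)
open import Data.Nat.Combinatorics using (_C_)
open import Data.Product.Base using (_×_)
open import Data.Rational.Base using (ℚ; 0ℚ; 1ℚ; -½; _+_; _-_; _*_; -_; _/_)
open import Data.Rational.Properties using (+-0-commutativeMonoid)
import Data.Vec.Functional as Vector
open Vector using (Vector)
open import Relation.Binary.PropositionalEquality using (_≡_; _≢_)
open import Relation.Nullary.Decidable.Core using (does)

open import Algebra.Properties.CommutativeMonoid.Sum +-0-commutativeMonoid using (sum)

fromℕ : ℕ → ℚ
fromℕ n = ℤ.+ n / 1

δ : ℕ → ℕ → ℚ
δ m n = if does (m ≟ n) then 1ℚ else 0ℚ

binom : ℕ → ℕ → ℚ
binom n k = fromℕ (n C k)

------------------------------------------------------------------------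
-- ℚ[X,Y]

-- c X^ i Y^ j is the term c·XⁱYʲ.
infix 8 _X^_Y^_
data Term : Set where
  _X^_Y^_ : ℚ → ℕ → ℕ → Term

-- A polynomial is a formal sum of terms, in which monomials may repeat and
-- coefficients may vanish; equality of polynomials is _≈_, not _≡_.
Poly : Set
Poly = List Term

coeff : Poly → ℕ → ℕ → ℚ
coeff []                  i j = 0ℚ
coeff ((c X^ a Y^ b) ∷ P) i j = c * (δ a i * δ b j) + coeff P i j

infix 4 _≈_
_≈_ : Poly → Poly → Set
P ≈ Q = ∀ i j → coeff P i j ≡ coeff Q i j

infixl 6 _⊕_ _⊖_
infixl 7 _⊗_
infixr 8 _^_

𝟘 𝟙 X Y : Poly
𝟘 = []
𝟙 = (1ℚ X^ 0 Y^ 0) ∷ []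
X = (1ℚ X^ 1 Y^ 0) ∷ []
Y = (1ℚ X^ 0 Y^ 1) ∷ []

_⊕_ : Poly → Poly → Poly
_⊕_ = _++_

scale : ℚ → Poly → Poly
scale a = map λ { (c X^ i Y^ j) → (a * c) X^ i Y^ j }

neg : Poly → Poly
neg = scale (- 1ℚ)

_⊖_ : Poly → Poly → Poly
P ⊖ Q = P ⊕ neg Q

_⊗_ : Poly → Poly → Poly
_⊗_ = cartesianProductWith
  λ { (c X^ i Y^ j) (d X^ k Y^ l) → (c * d) X^ (i ℕ.+ k) Y^ (j ℕ.+ l) }

_^_ : Poly → ℕ → Poly
P ^ zero  = 𝟙
P ^ suc n = P ⊗ P ^ n

-- P ⟨ Q , R ⟩ is P(Q,R).
infix 9 _⟨_,_⟩
_⟨_,_⟩ : Poly → Poly → Poly → Poly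
[]                  ⟨ Q , R ⟩ = 𝟘
((c X^ i Y^ j) ∷ P) ⟨ Q , R ⟩ = scale c (Q ^ i ⊗ R ^ j) ⊕ P ⟨ Q , R ⟩

∂X : Poly → Poly
∂X = map λ { (c X^ i Y^ j) → (fromℕ i * c) X^ (i ∸ 1) Y^ j }

Homogeneous : ℕ → Poly → Set
Homogeneous d P = ∀ i j → i ℕ.+ j ≢ d → coeff P i j ≡ 0ℚ

------------------------------------------------------------------------
-- Period polynomials

record W (w : ℕ) (P : Poly) : Set where
  field
    homogeneous : Homogeneous (w ∸ 2) P
    two-term    : P ⊕ P ⟨ neg Y , X ⟩ ≈ 𝟘
    three-term  : P ⊕ P ⟨ X ⊖ Y , X ⟩ ⊕ P ⟨ Y , Y ⊖ X ⟩ ≈ 𝟘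

W⁺ W⁻ : ℕ → Poly → Set
W⁺ w P = W w P × P ≈ P ⟨ Y , X ⟩
W⁻ w P = W w P × P ≈ neg (P ⟨ Y , X ⟩)

------------------------------------------------------------------------
-- Coefficients of the relations in weight k = 2K+1

weight : ℕ → ℕ
weight K = 2 ℕ.* K ℕ.+ 1

-- In both sums r = t + 1 and s = k ∸ r.  For Type I the pair (r , s) = (2K , 1)
-- would contribute b₂ₖ,₁ Y⁻¹, so the identity forces b₂ₖ,₁ = 0 and the sum is
-- over s ≥ 2.
TypeI : ℕ → Poly → (ℕ → ℕ → ℚ) → Set
TypeI K p b = b (2 ℕ.* K) 1 ≡ 0ℚ × p ⟨ X ⊕ Y , Y ⟩ ≈ map term (upTo (2 ℕ.* K ∸ 1))
  where
  term : ℕ → Term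
  term t = let r = suc t; s = weight K ∸ r in
    (binom (2 ℕ.* K ∸ 1) (r ∸ 1) * b r s) X^ (r ∸ 1) Y^ (s ∸ 2)

TypeII : ℕ → Poly → (ℕ → ℕ → ℚ) → Set
TypeII K p c = ∂X (p ⟨ X ⊕ Y , Y ⟩) ≈ map term (upTo (2 ℕ.* K))
  where
  term : ℕ → Term
  term t = let r = suc t; s = weight K ∸ r in
    (binom (2 ℕ.* K ∸ 1) (r ∸ 1) * c r s) X^ (r ∸ 1) Y^ (s ∸ 1)

-- The entry at index zero is v₁; the entry at index suc j is vᵢ with i = j + 2.
relationVector : (K : ℕ) → (ℕ → ℕ → ℚ) → Vector ℚ (K ∸ 1)
relationVector K a j = v (toℕ j)
  where
  v : ℕ → ℚ
  v zero    = 0ℚ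
  v (suc j) = let i = 2 ℕ.+ j; k = weight K in
    a (2 ℕ.* i) (k ∸ 2 ℕ.* i) - a (k ∸ 2 ℕ.* i) (2 ℕ.* i)

------------------------------------------------------------------------
-- Matrices

Matrix : ℕ → ℕ → Set
Matrix m n = Vector (Vector ℚ n) m

deleteLastRow : ∀ {m n} → Matrix (suc m) n → Matrix m n
deleteLastRow = Vector.init

deleteLastColumn : ∀ {m n} → Matrix m (suc n) → Matrix m n
deleteLastColumn M = Vector.map Vector.init M

_∈LeftKernel_ : ∀ {m n} → Vector ℚ m → Matrix m n → Set
v ∈LeftKernel M = ∀ n → sum (λ i → v i * M i n) ≡ 0ℚ

-- The coefficient of ζ(2n+1)ζ(k-2n-1) in ζ(k-2m-1,2m+1), for k = 2K+1.
zagier : (K m n : ℕ) → ℚ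
zagier K m n =
  δ n m + δ n K
    - binom (2 ℕ.* n) (2 ℕ.* m)
    - binom (2 ℕ.* n) (2 ℕ.* K ∸ 2 ℕ.* m ∸ 1)

-- Row i is ζ(2i,k-2i), that is m = K-i; in the last column ζ(k)ζ(0) = -½ζ(k).
𝓑 : (K : ℕ) → Matrix K K
𝓑 K i′ n′ = if does (n ≟ K) then zagier K (K ∸ i) n * -½ else zagier K (K ∸ i) n
  where
  i = suc (toℕ i′)
  n = suc (toℕ n′)

𝓑¹ : (K : ℕ) → Matrix (K ∸ 1) (K ∸ 1)
𝓑¹ zero    = λ ()
𝓑¹ (suc K) = deleteLastColumn (deleteLastRow (𝓑 (suc K)))

{-# OPTIONS --safe #-}
module Submission where

-- Put M = 2K-1, let β₀, …, β_M be the coefficients b (or c), and let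
-- G(x,y) = Σ C(M,a) β_a xᵃ y^(M-a), that is y p(x+y,y) (or p_X(x+y,y)).  The
-- antisymmetrisation F(x,y) = G(x,y) - G(y,x) has coefficients
-- D_a = β_a - β_(M-a), and the period relations give F(-x,x+y) = F(x,y).  For
-- y = 1, comparing coefficients of xⁿ turns this into
-- Σ_a (-1)ᵃ C(n,a) D_a = D_n.  For even n, folding the even a by
-- D_a = -D_(M-a) leaves only the D_(2i-1), the entries of the relation vector,
-- and gives the column of the kernel equation with index n/2; the omitted last
-- row is harmless because D_M = -D_0 = 0.
-- Polynomials are treated through their values on ℚ; derivatives are read off
-- from values on the dual numbers.

open import Defs renaming (_≈_ to _≈ᴾ_; _^_ to _^ᴾ_)

open import Algebra.Bundles using (CommutativeRing)
import Algebra.Module.Construct.Idealization as Idealization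
import Algebra.Module.Construct.TensorUnit as TensorUnit
import Algebra.Morphism.Construct.Identity as Identity
open import Algebra.Morphism.Structures using (module RingMorphisms)
import Algebra.Properties.CommutativeMonoid.Sum as CommutativeSum
import Algebra.Properties.CommutativeSemigroup as CommutativeSemigroupProperties
import Algebra.Properties.CommutativeSemiring.Binomial as Binomial
import Algebra.Properties.CommutativeSemiring.Exp as CommutativeExp
import Algebra.Properties.Ring as RingProperties
import Algebra.Properties.Semiring.Exp as Exp
import Algebra.Properties.Semiring.Mult as Mult
import Algebra.Properties.Semiring.Sum as Sum
open import Data.Bool.Base using (if_then_else_)
open import Data.Empty using (⊥)
open import Data.Fin.Base as Fin using (Fin; zero; suc; toℕ)
open import Data.Fin.Permutation using (reverse)
import Data.Fin.Properties as Fin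
import Data.Integer.Base as ℤ
import Data.Integer.Properties as ℤ
import Data.Integer.Tactic.RingSolver as ℤSolver
open import Data.List.Base using ([]; _∷_; map; upTo; applyUpTo)
open import Data.Nat.Base as ℕ using (ℕ; zero; suc; _∸_)
open import Data.Nat.Combinatorics
  using (_C_; nC1≡n; nCk≡nC[n∸k]; nCk+nC[k+1]≡[n+1]C[k+1]; k>n⇒nCk≡0)
import Data.Nat.Properties as ℕ
import Data.Nat.Tactic.RingSolver as ℕSolver
open import Data.Product.Base using (_×_; _,_; proj₁; proj₂)
open import Data.Rational.Base
  using (ℚ; 0ℚ; 1ℚ; -½; _+_; _-_; _*_; -_; 1/_; toℚᵘ; ≢-nonZero)
import Data.Rational.Properties as ℚ
open import Data.Rational.Solver using (module +-*-Solver)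
open import Data.Rational.Unnormalised.Base as ℚᵘ using (mkℚᵘ; *≡*)
import Data.Rational.Unnormalised.Properties as ℚᵘ
open import Data.Sum.Base using (_⊎_; inj₁; inj₂)
open import Function.Base using (id)
open import Level using (0ℓ)
open import Relation.Binary.PropositionalEquality as ≡ using (_≡_; _≢_)
import Relation.Binary.Reasoning.Setoid as SetoidReasoning
open import Relation.Nullary.Decidable using (does; dec-false)

-- Why F is invariant: (x,y) -> (-x,x+y) is an involution that replaces x+y by y. F is built from
-- values at (x+y,y) and (x+y,x), which it moves to (y,x+y) and (y,-x). Up to the symmetry and
-- parity of p, or of its X-derivative, these are the points that occur in the three-term relation
-- after X is replaced by X+Y.
--
-- The relation vector sets its first entry to 0, whereas the fold produces D_1 there, so D_1 = 0
-- has to be proved. Setting n = 1 in the coefficient identity gives D_0 - D_1 = D_1, and D_0 = 0 is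
-- the equality G(1,0) = G(0,1), a degenerate case of the three-term relation.
--
-- A `Poly` is an unnormalised list, which makes direct manipulation of coefficients under
-- substitution awkward. Values turn every substitution into ordinary algebra; the price is a lemma
-- that recovers coefficients from values.

module Evaluation (R : CommutativeRing 0ℓ 0ℓ)
  (ι : ℚ → CommutativeRing.Carrier R)
  (ι-isRingHomomorphism :
    RingMorphisms.IsRingHomomorphism ℚ.+-*-rawRing (CommutativeRing.rawRing R) ι)
  where

  private
    module R = CommutativeRing R
    module ι = RingMorphisms.IsRingHomomorphism ι-isRingHomomorphism
  open R using (Carrier; _≈_; 0#; 1#)
  open Exp R.semiring using (_^_; ^-homo-*; ^-congˡ)
  open Sum R.semiring using (sum; sum-cong-≋; sum-syntax; ∑-distrib-+; *-distribˡ-sum; sum-replicate-zero)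
  open CommutativeSemigroupProperties R.*-commutativeSemigroup using (interchange; xy∙z≈y∙xz)
  open RingProperties R.ring using (-1*x≈-x; -‿+-comm; +-inverseˡ-unique; +-inverseʳ-unique)
  open SetoidReasoning R.setoid

  -- Values of polynomials in a commutative ring under ℚ

  ⟦_⟧ₜ : Term → (ℕ → ℕ → Carrier) → Carrier
  ⟦ c X^ i Y^ j ⟧ₜ φ = ι c R.* φ i j

  -- The linear extension of an arbitrary assignment φ of values to monomials. Keeping φ arbitrary
  -- separates the linear facts from the multiplicative ones, which need φ = `monomial x y`.
  ⟦_⟧ : Poly → (ℕ → ℕ → Carrier) → Carrier
  ⟦ [] ⟧    φ = 0#
  ⟦ t ∷ P ⟧ φ = ⟦ t ⟧ₜ φ R.+ ⟦ P ⟧ φ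

  monomial : Carrier → Carrier → ℕ → ℕ → Carrier
  monomial x y i j = x ^ i R.* y ^ j

  eval : Poly → Carrier → Carrier → Carrier
  eval P x y = ⟦ P ⟧ (monomial x y)

  monomial-cong : ∀ {x x′ y y′} → x ≈ x′ → y ≈ y′ → ∀ i j → monomial x y i j ≈ monomial x′ y′ i j
  monomial-cong p q i j = R.*-cong (^-congˡ i p) (^-congˡ j q)

  eval-cong : ∀ P {x x′ y y′} → x ≈ x′ → y ≈ y′ → eval P x y ≈ eval P x′ y′
  eval-cong []                  p q = R.refl
  eval-cong ((c X^ i Y^ j) ∷ P) p q = R.+-cong (R.*-congˡ (monomial-cong p q i j)) (eval-cong P p q)

  ∑-zero : ∀ n (f : Fin n → Carrier) → (∀ i → f i ≈ 0#) → sum f ≈ 0#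
  ∑-zero n f f≈0 = R.trans (sum-cong-≋ f≈0) (sum-replicate-zero n)

  ∑-δ : ∀ {a n} → a ℕ.< n → (f : ℕ → Carrier) → ∑[ i < n ] (ι (δ a (toℕ i)) R.* f (toℕ i)) ≈ f a
  ∑-δ {zero} {suc n} _ f = begin
    ι 1ℚ R.* f 0 R.+ ∑[ i < n ] (ι 0ℚ R.* f (suc (toℕ i)))
      ≈⟨ R.+-cong (R.trans (R.*-congʳ ι.1#-homo) (R.*-identityˡ _))
                  (∑-zero n _ (λ i → R.trans (R.*-congʳ ι.0#-homo) (R.zeroˡ _))) ⟩
    f 0 R.+ 0#  ≈⟨ R.+-identityʳ _ ⟩
    f 0         ∎
  ∑-δ {suc a} {suc n} (ℕ.s≤s a<n) f = begin
    ι 0ℚ R.* f 0 R.+ ∑[ i < n ] (ι (δ a (toℕ i)) R.* f (suc (toℕ i)))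
      ≈⟨ R.+-cong (R.trans (R.*-congʳ ι.0#-homo) (R.zeroˡ _)) (∑-δ a<n (λ i → f (suc i))) ⟩
    0# R.+ f (suc a)  ≈⟨ R.+-identityˡ _ ⟩
    f (suc a)         ∎

  -- A strict bound on the exponents of all listed terms, including those that cancel, so that each
  -- term has an index inside the square of summation.
  degreeBound : Poly → ℕ
  degreeBound []                  = 0
  degreeBound ((c X^ i Y^ j) ∷ P) = suc (i ℕ.⊔ j) ℕ.⊔ degreeBound P

  -- Equality of polynomials only compares `coeff`, so values must be expressed through it. Any
  -- sufficiently large N is allowed, so that two polynomials can be compared over one common
  -- square.
  ⟦⟧-coeff : ∀ P φ {N} → degreeBound P ℕ.≤ N →
    ⟦ P ⟧ φ ≈ ∑[ i < N ] ∑[ j < N ] (ι (coeff P (toℕ i) (toℕ j)) R.* φ (toℕ i) (toℕ j))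
  ⟦⟧-coeff [] φ {N} _ = R.sym (∑-zero N _ λ i → ∑-zero N _ λ j →
    R.trans (R.*-congʳ ι.0#-homo) (R.zeroˡ _))
  ⟦⟧-coeff ((c X^ a Y^ b) ∷ P) φ {N} bound = R.sym (begin
    ∑[ i < N ] ∑[ j < N ] (ι (c * (δ a (toℕ i) * δ b (toℕ j)) + coeff P (toℕ i) (toℕ j)) R.* φ (toℕ i) (toℕ j))
      ≈⟨ (sum-cong-≋ λ i → R.trans (sum-cong-≋ λ j → expand i j) (∑-distrib-+ (head i) (rest i))) ⟩
    ∑[ i < N ] (∑[ j < N ] head i j R.+ ∑[ j < N ] rest i j)
      ≈⟨ ∑-distrib-+ (λ i → ∑[ j < N ] head i j) (λ i → ∑[ j < N ] rest i j) ⟩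
    ∑[ i < N ] ∑[ j < N ] head i j R.+ ∑[ i < N ] ∑[ j < N ] rest i j
      ≈⟨ R.+-cong (R.trans (sum-cong-≋ λ i → R.trans (collapse i) (xy∙z≈y∙xz _ _ _)) (∑-δ a<N (λ i → ι c R.* φ i b)))
                  (R.sym (⟦⟧-coeff P φ (ℕ.≤-trans (ℕ.m≤n⊔m (suc (a ℕ.⊔ b)) (degreeBound P)) bound))) ⟩
    ι c R.* φ a b R.+ ⟦ P ⟧ φ ∎)
    where
    suc[a⊔b]≤N : suc (a ℕ.⊔ b) ℕ.≤ N
    suc[a⊔b]≤N = ℕ.≤-trans (ℕ.m≤m⊔n _ (degreeBound P)) bound
    a<N : a ℕ.< N
    a<N = ℕ.≤-trans (ℕ.s≤s (ℕ.m≤m⊔n a b)) suc[a⊔b]≤N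
    b<N : b ℕ.< N
    b<N = ℕ.≤-trans (ℕ.s≤s (ℕ.m≤n⊔m a b)) suc[a⊔b]≤N
    head rest : Fin N → Fin N → Carrier
    head i j = ι c R.* ι (δ a (toℕ i)) R.* (ι (δ b (toℕ j)) R.* φ (toℕ i) (toℕ j))
    rest i j = ι (coeff P (toℕ i) (toℕ j)) R.* φ (toℕ i) (toℕ j)
    expand : ∀ i j →
      ι (c * (δ a (toℕ i) * δ b (toℕ j)) + coeff P (toℕ i) (toℕ j)) R.* φ (toℕ i) (toℕ j) ≈ head i j R.+ rest i j
    expand i j = begin
      ι (c * (δ a (toℕ i) * δ b (toℕ j)) + coeff P (toℕ i) (toℕ j)) R.* φ (toℕ i) (toℕ j)
        ≈⟨ R.*-congʳ (ι.+-homo _ _) ⟩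
      (ι (c * (δ a (toℕ i) * δ b (toℕ j))) R.+ ι (coeff P (toℕ i) (toℕ j))) R.* φ (toℕ i) (toℕ j)
        ≈⟨ R.distribʳ _ _ _ ⟩
      ι (c * (δ a (toℕ i) * δ b (toℕ j))) R.* φ (toℕ i) (toℕ j) R.+ rest i j
        ≈⟨ R.+-congʳ (R.*-congʳ (R.trans (ι.*-homo _ _) (R.trans (R.*-congˡ (ι.*-homo _ _)) (R.sym (R.*-assoc _ _ _))))) ⟩
      ι c R.* ι (δ a (toℕ i)) R.* ι (δ b (toℕ j)) R.* φ (toℕ i) (toℕ j) R.+ rest i j
        ≈⟨ R.+-congʳ (R.*-assoc _ _ _) ⟩
      head i j R.+ rest i j ∎
    collapse : ∀ i → ∑[ j < N ] head i j ≈ ι c R.* ι (δ a (toℕ i)) R.* φ (toℕ i) b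
    collapse i = R.trans (R.sym (*-distribˡ-sum {N} _ (λ j → ι (δ b (toℕ j)) R.* φ (toℕ i) (toℕ j))))
                         (R.*-congˡ (∑-δ b<N (φ (toℕ i))))

  ⟦⟧-cong : ∀ P Q → P ≈ᴾ Q → ∀ φ → ⟦ P ⟧ φ ≈ ⟦ Q ⟧ φ
  ⟦⟧-cong P Q P≈Q φ = begin
    ⟦ P ⟧ φ
      ≈⟨ ⟦⟧-coeff P φ (ℕ.m≤m⊔n (degreeBound P) (degreeBound Q)) ⟩
    ∑[ i < N ] ∑[ j < N ] (ι (coeff P (toℕ i) (toℕ j)) R.* φ (toℕ i) (toℕ j))
      ≈⟨ (sum-cong-≋ {N} λ i → sum-cong-≋ {N} λ j →
           R.reflexive (≡.cong (λ c → ι c R.* φ (toℕ i) (toℕ j)) (P≈Q (toℕ i) (toℕ j)))) ⟩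
    ∑[ i < N ] ∑[ j < N ] (ι (coeff Q (toℕ i) (toℕ j)) R.* φ (toℕ i) (toℕ j))
      ≈⟨ ⟦⟧-coeff Q φ (ℕ.m≤n⊔m (degreeBound P) (degreeBound Q)) ⟨
    ⟦ Q ⟧ φ ∎
    where N = degreeBound P ℕ.⊔ degreeBound Q

  ⟦⟧-⊕ : ∀ P Q φ → ⟦ P ⊕ Q ⟧ φ ≈ ⟦ P ⟧ φ R.+ ⟦ Q ⟧ φ
  ⟦⟧-⊕ []      Q φ = R.sym (R.+-identityˡ _)
  ⟦⟧-⊕ (t ∷ P) Q φ = R.trans (R.+-congˡ (⟦⟧-⊕ P Q φ)) (R.sym (R.+-assoc _ _ _))

  ⟦⟧-map : ∀ (f : Term → Term) e φ → (∀ t → ⟦ f t ⟧ₜ φ ≈ e R.* ⟦ t ⟧ₜ φ) →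
    ∀ P → ⟦ map f P ⟧ φ ≈ e R.* ⟦ P ⟧ φ
  ⟦⟧-map f e φ f-scales []      = R.sym (R.zeroʳ e)
  ⟦⟧-map f e φ f-scales (t ∷ P) = R.trans
    (R.+-cong (f-scales t) (⟦⟧-map f e φ f-scales P)) (R.sym (R.distribˡ e _ _))

  ⟦⟧-scale : ∀ c P φ → ⟦ scale c P ⟧ φ ≈ ι c R.* ⟦ P ⟧ φ
  ⟦⟧-scale c P φ = ⟦⟧-map _ (ι c) φ
    (λ { (d X^ i Y^ j) → R.trans (R.*-congʳ (ι.*-homo c d)) (R.*-assoc _ _ _) }) P

  ⟦⟧-neg : ∀ P φ → ⟦ neg P ⟧ φ ≈ R.- ⟦ P ⟧ φ
  ⟦⟧-neg P φ = begin
    ⟦ neg P ⟧ φ              ≈⟨ ⟦⟧-scale (- 1ℚ) P φ ⟩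
    ι (- 1ℚ) R.* ⟦ P ⟧ φ     ≈⟨ R.*-congʳ (R.trans (ι.-‿homo 1ℚ) (R.-‿cong ι.1#-homo)) ⟩
    (R.- 1#) R.* ⟦ P ⟧ φ     ≈⟨ -1*x≈-x _ ⟩
    R.- ⟦ P ⟧ φ              ∎

  eval-⊕ : ∀ P Q x y {p q} → eval P x y ≈ p → eval Q x y ≈ q → eval (P ⊕ Q) x y ≈ p R.+ q
  eval-⊕ P Q x y ≈p ≈q = R.trans (⟦⟧-⊕ P Q _) (R.+-cong ≈p ≈q)

  eval-neg : ∀ P x y {p} → eval P x y ≈ p → eval (neg P) x y ≈ R.- p
  eval-neg P x y ≈p = R.trans (⟦⟧-neg P _) (R.-‿cong ≈p)

  eval-⊗ : ∀ P Q x y → eval (P ⊗ Q) x y ≈ eval P x y R.* eval Q x y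
  eval-⊗ []                  Q x y = R.sym (R.zeroˡ _)
  eval-⊗ ((c X^ i Y^ j) ∷ P) Q x y = begin
    eval (((c X^ i Y^ j) ∷ P) ⊗ Q) x y
      ≈⟨ ⟦⟧-⊕ (map _ Q) (P ⊗ Q) _ ⟩
    _ R.+ eval (P ⊗ Q) x y
      ≈⟨ R.+-cong (⟦⟧-map _ (ι c R.* monomial x y i j) (monomial x y) scales Q) (eval-⊗ P Q x y) ⟩
    ι c R.* monomial x y i j R.* eval Q x y R.+ eval P x y R.* eval Q x y
      ≈⟨ R.distribʳ _ _ _ ⟨
    (ι c R.* monomial x y i j R.+ eval P x y) R.* eval Q x y ∎
    where
    scales : ∀ t → _
    scales (d X^ k Y^ l) = begin
      ι (c * d) R.* (x ^ (i ℕ.+ k) R.* y ^ (j ℕ.+ l))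
        ≈⟨ R.*-cong (ι.*-homo c d) (R.*-cong (^-homo-* x i k) (^-homo-* y j l)) ⟩
      (ι c R.* ι d) R.* ((x ^ i R.* x ^ k) R.* (y ^ j R.* y ^ l))
        ≈⟨ R.*-congˡ (interchange _ _ _ _) ⟩
      (ι c R.* ι d) R.* (monomial x y i j R.* monomial x y k l)
        ≈⟨ interchange _ _ _ _ ⟩
      (ι c R.* monomial x y i j) R.* (ι d R.* monomial x y k l) ∎

  eval-term : ∀ i j x y → eval ((1ℚ X^ i Y^ j) ∷ []) x y ≈ monomial x y i j
  eval-term i j x y = begin
    ι 1ℚ R.* monomial x y i j R.+ 0#  ≈⟨ R.+-identityʳ _ ⟩
    ι 1ℚ R.* monomial x y i j         ≈⟨ R.*-congʳ ι.1#-homo ⟩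
    1# R.* monomial x y i j           ≈⟨ R.*-identityˡ _ ⟩
    monomial x y i j                  ∎

  eval-X : ∀ x y → eval X x y ≈ x
  eval-X x y = R.trans (eval-term 1 0 x y) (R.trans (R.*-identityʳ _) (R.*-identityʳ _))

  eval-Y : ∀ x y → eval Y x y ≈ y
  eval-Y x y = R.trans (eval-term 0 1 x y) (R.trans (R.*-identityˡ _) (R.*-identityʳ _))

  eval-^ : ∀ P n x y → eval (P ^ᴾ n) x y ≈ eval P x y ^ n
  eval-^ P zero    x y = R.trans (eval-term 0 0 x y) (R.*-identityˡ _)
  eval-^ P (suc n) x y = R.trans (eval-⊗ P (P ^ᴾ n) x y) (R.*-congˡ (eval-^ P n x y))

  eval-⟨⟩ : ∀ P Q S {q s} x y → eval Q x y ≈ q → eval S x y ≈ s → eval (P ⟨ Q , S ⟩) x y ≈ eval P q s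
  eval-⟨⟩ []                  Q S x y _  _  = R.refl
  eval-⟨⟩ ((c X^ i Y^ j) ∷ P) Q S {q} {s} x y ≈q ≈s = begin
    eval (scale c (Q ^ᴾ i ⊗ S ^ᴾ j) ⊕ P ⟨ Q , S ⟩) x y
      ≈⟨ ⟦⟧-⊕ (scale c (Q ^ᴾ i ⊗ S ^ᴾ j)) (P ⟨ Q , S ⟩) _ ⟩
    eval (scale c (Q ^ᴾ i ⊗ S ^ᴾ j)) x y R.+ eval (P ⟨ Q , S ⟩) x y
      ≈⟨ R.+-cong (⟦⟧-scale c (Q ^ᴾ i ⊗ S ^ᴾ j) _) (eval-⟨⟩ P Q S x y ≈q ≈s) ⟩
    ι c R.* eval (Q ^ᴾ i ⊗ S ^ᴾ j) x y R.+ eval P q s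
      ≈⟨ R.+-congʳ (R.*-congˡ (R.trans (eval-⊗ (Q ^ᴾ i) (S ^ᴾ j) x y)
           (R.*-cong (R.trans (eval-^ Q i x y) (^-congˡ i ≈q)) (R.trans (eval-^ S j x y) (^-congˡ j ≈s))))) ⟩
    ι c R.* monomial q s i j R.+ eval P q s ∎

  ⟦⟧-upTo : ∀ (f : ℕ → Term) φ n → ⟦ map f (upTo n) ⟧ φ ≈ ∑[ a < n ] (⟦ f (toℕ a) ⟧ₜ φ)
  ⟦⟧-upTo f φ n = go (λ a → a) n
    where
    go : ∀ g n → ⟦ map f (applyUpTo g n) ⟧ φ ≈ ∑[ a < n ] (⟦ f (g (toℕ a)) ⟧ₜ φ)
    go g zero    = R.refl
    go g (suc n) = R.+-congˡ (go (λ a → g (suc a)) n)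


  -- Period relations as identities between values

  eval-swap : ∀ P x y → eval (P ⟨ Y , X ⟩) x y ≈ eval P y x
  eval-swap P x y = eval-⟨⟩ P Y X x y (eval-Y x y) (eval-X x y)

  eval-shift : ∀ P x y → eval (P ⟨ X ⊕ Y , Y ⟩) x y ≈ eval P (x R.+ y) y
  eval-shift P x y =
    eval-⟨⟩ P (X ⊕ Y) Y x y (eval-⊕ X Y x y (eval-X x y) (eval-Y x y)) (eval-Y x y)

  module _ {w P} (P∈W : W w P) where

    open W P∈W

    eval-two-term : ∀ x y → eval P x y R.+ eval P (R.- y) x ≈ 0#
    eval-two-term x y = R.trans
      (R.sym (eval-⊕ P (P ⟨ neg Y , X ⟩) x y R.refl
        (eval-⟨⟩ P (neg Y) X x y (eval-neg Y x y (eval-Y x y)) (eval-X x y))))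
      (⟦⟧-cong (P ⊕ P ⟨ neg Y , X ⟩) 𝟘 two-term _)

    eval-three-term : ∀ x y → eval P x y R.+ eval P (x R.- y) x R.+ eval P y (y R.- x) ≈ 0#
    eval-three-term x y = R.trans
      (R.sym (eval-⊕ (P ⊕ P ⟨ X ⊖ Y , X ⟩) (P ⟨ Y , Y ⊖ X ⟩) x y
        (eval-⊕ P (P ⟨ X ⊖ Y , X ⟩) x y R.refl
          (eval-⟨⟩ P (X ⊖ Y) X x y (eval-⊕ X (neg Y) x y (eval-X x y) (eval-neg Y x y (eval-Y x y))) (eval-X x y)))
        (eval-⟨⟩ P Y (Y ⊖ X) x y (eval-Y x y) (eval-⊕ Y (neg X) x y (eval-Y x y) (eval-neg X x y (eval-X x y))))))
      (⟦⟧-cong (P ⊕ P ⟨ X ⊖ Y , X ⟩ ⊕ P ⟨ Y , Y ⊖ X ⟩) 𝟘 three-term _)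

    -- The three-term relation at (x + y , y), which makes its first summand the value p(x+y,y) from
    -- which both types of relations are built.
    eval-three-term′ : ∀ x y → eval P (x R.+ y) y R.+ eval P x (x R.+ y) R.+ eval P y (R.- x) ≈ 0#
    eval-three-term′ x y = R.trans
      (R.sym (R.+-cong (R.+-congˡ (eval-cong P x+y-y≈x R.refl)) (eval-cong P R.refl y-[x+y]≈-x)))
      (eval-three-term (x R.+ y) y)
      where
      x+y-y≈x : x R.+ y R.- y ≈ x
      x+y-y≈x = R.trans (R.+-assoc x y _) (R.trans (R.+-congˡ (R.-‿inverseʳ y)) (R.+-identityʳ x))
      y-[x+y]≈-x : y R.- (x R.+ y) ≈ R.- x
      y-[x+y]≈-x = R.trans (R.+-congˡ (R.trans (R.-‿cong (R.+-comm x y)) (R.sym (-‿+-comm y x))))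
        (R.trans (R.sym (R.+-assoc y _ _)) (R.trans (R.+-congʳ (R.-‿inverseʳ y)) (R.+-identityˡ _)))

  module _ {w P} (P∈W⁺ : W⁺ w P) where

    eval-symmetric : ∀ x y → eval P x y ≈ eval P y x
    eval-symmetric x y = R.trans (⟦⟧-cong P (P ⟨ Y , X ⟩) (proj₂ P∈W⁺) _) (eval-swap P x y)

    -- By symmetry the summand P(-y,x) of the two-term relation is P(x,-y).
    eval-oddʳ : ∀ x y → eval P x (R.- y) ≈ R.- eval P x y
    eval-oddʳ x y = R.trans (eval-symmetric x (R.- y))
      (+-inverseʳ-unique _ _ (eval-two-term (proj₁ P∈W⁺) x y))

  module _ {w P} (P∈W⁻ : W⁻ w P) where

    eval-antisymmetric : ∀ x y → eval P x y ≈ R.- eval P y x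
    eval-antisymmetric x y = R.trans (⟦⟧-cong P (neg (P ⟨ Y , X ⟩)) (proj₂ P∈W⁻) _)
      (eval-neg (P ⟨ Y , X ⟩) x y (eval-swap P x y))

    -- Antisymmetry adds a sign to the argument for W⁺, so the two-term relation now gives evenness.
    eval-evenʳ : ∀ x y → eval P x (R.- y) ≈ eval P x y
    eval-evenʳ x y = R.trans (eval-antisymmetric x (R.- y))
      (R.sym (+-inverseˡ-unique _ _ (eval-two-term (proj₁ P∈W⁻) x y)))

    eval-evenˡ : ∀ x y → eval P (R.- x) y ≈ eval P x y
    eval-evenˡ x y = R.trans (eval-antisymmetric (R.- x) y)
      (R.trans (R.-‿cong (eval-evenʳ y x)) (R.sym (eval-antisymmetric x y)))

-- The embedding of ℕ in ℚ

module ℚ-Ring = CommutativeRing ℚ.+-*-commutativeRing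
open Exp ℚ-Ring.semiring using (_^_)
open CommutativeExp ℚ-Ring.commutativeSemiring using (^-distrib-*)
open CommutativeSum ℚ-Ring.+-commutativeMonoid using (sum-permute; ∑-comm)
open Sum ℚ-Ring.semiring using (sum-cong-≗; sum-syntax; ∑-distrib-+; *-distribˡ-sum)

toℚᵘ-fromℕ : ∀ n → toℚᵘ (fromℕ n) ℚᵘ.≃ mkℚᵘ (ℤ.+ n) 0
toℚᵘ-fromℕ n = ℚ.toℚᵘ-fromℚᵘ (mkℚᵘ (ℤ.+ n) 0)

fromℕ-+ : ∀ m n → fromℕ (m ℕ.+ n) ≡ fromℕ m + fromℕ n
fromℕ-+ m n = ℚ.toℚᵘ-injective (begin
  toℚᵘ (fromℕ (m ℕ.+ n))                    ≈⟨ toℚᵘ-fromℕ (m ℕ.+ n) ⟩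
  mkℚᵘ (ℤ.+ m ℤ.+ ℤ.+ n) 0                  ≈⟨ *≡* (lemma (ℤ.+ m) (ℤ.+ n)) ⟩
  mkℚᵘ (ℤ.+ m) 0 ℚᵘ.+ mkℚᵘ (ℤ.+ n) 0        ≈⟨ ℚᵘ.+-cong (toℚᵘ-fromℕ m) (toℚᵘ-fromℕ n) ⟨
  toℚᵘ (fromℕ m) ℚᵘ.+ toℚᵘ (fromℕ n)        ≈⟨ ℚ.toℚᵘ-homo-+ (fromℕ m) (fromℕ n) ⟨
  toℚᵘ (fromℕ m + fromℕ n)                  ∎)
  where
  open ℚᵘ.≃-Reasoning
  lemma : ∀ i j → (i ℤ.+ j) ℤ.* (ℤ.+ 1 ℤ.* ℤ.+ 1) ≡ (i ℤ.* ℤ.+ 1 ℤ.+ j ℤ.* ℤ.+ 1) ℤ.* ℤ.+ 1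
  lemma = ℤSolver.solve-∀

fromℕ-suc : ∀ n → fromℕ (suc n) ≡ 1ℚ + fromℕ n
fromℕ-suc = fromℕ-+ 1

fromℕ-* : ∀ m n → fromℕ (m ℕ.* n) ≡ fromℕ m * fromℕ n
fromℕ-* zero    n = ≡.sym (ℚ.*-zeroˡ (fromℕ n))
fromℕ-* (suc m) n = begin
  fromℕ (n ℕ.+ m ℕ.* n)              ≡⟨ fromℕ-+ n (m ℕ.* n) ⟩
  fromℕ n + fromℕ (m ℕ.* n)          ≡⟨ ≡.cong (fromℕ n +_) (fromℕ-* m n) ⟩
  fromℕ n + fromℕ m * fromℕ n        ≡⟨ ≡.cong (_+ fromℕ m * fromℕ n) (ℚ.*-identityˡ (fromℕ n)) ⟨
  1ℚ * fromℕ n + fromℕ m * fromℕ n   ≡⟨ ℚ.*-distribʳ-+ (fromℕ n) 1ℚ (fromℕ m) ⟨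
  (1ℚ + fromℕ m) * fromℕ n           ≡⟨ ≡.cong (_* fromℕ n) (fromℕ-suc m) ⟨
  fromℕ (suc m) * fromℕ n            ∎
  where open ≡.≡-Reasoning

module ℚ-Evaluation =
  Evaluation ℚ.+-*-commutativeRing id (Identity.isRingHomomorphism ℚ.+-*-rawRing ≡.refl)

open ℚ-Evaluation using (eval; monomial; ∑-zero; ∑-δ)

-- Dual numbers and partial derivatives

module Dual = Idealization ℚ-Ring.ring TensorUnit.bimodule

-- ℚ[ε]/(ε²), with (a , b) standing for a + bε.
dualNumbers : CommutativeRing 0ℓ 0ℓ
dualNumbers = record
  { isCommutativeRing = record
    { isRing = Dual.isRingᴺ
    ; *-comm = λ (a , a′) (b , b′) → ℚ.*-comm a b ,
        solve 4 (λ a a′ b b′ → a :* b′ :+ a′ :* b := b :* a′ :+ b′ :* a) ≡.refl a a′ b b′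
    }
  }
  where open +-*-Solver

module Dual-Ring = CommutativeRing dualNumbers
module Dual-Exp = Exp Dual-Ring.semiring

ι : ℚ → ℚ × ℚ
ι a = a , 0ℚ

ι-isRingHomomorphism : RingMorphisms.IsRingHomomorphism ℚ.+-*-rawRing Dual-Ring.rawRing ι
ι-isRingHomomorphism = record
  { isSemiringHomomorphism = record
    { isNearSemiringHomomorphism = record
      { +-isMonoidHomomorphism = record
        { isMagmaHomomorphism = record
          { isRelHomomorphism = record { cong = λ a≡b → a≡b , ≡.refl }
          ; homo = λ a b → ≡.refl , ≡.refl
          }
        ; ε-homo = ≡.refl , ≡.refl
        }
      ; *-homo = λ a b → ≡.refl ,
          solve 2 (λ a b → con 0ℚ := a :* con 0ℚ :+ con 0ℚ :* b) ≡.refl a b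
      }
    ; 1#-homo = ≡.refl , ≡.refl
    }
  ; -‿homo = λ a → ≡.refl , ≡.refl
  }
  where open +-*-Solver

module Dual-Evaluation = Evaluation dualNumbers ι ι-isRingHomomorphism

evalᴰ : Poly → ℚ × ℚ → ℚ × ℚ → ℚ × ℚ
evalᴰ = Dual-Evaluation.eval

∂Y : Poly → Poly
∂Y = map λ { (c X^ i Y^ j) → (fromℕ j * c) X^ i Y^ (j ∸ 1) }

proj₁-^ : ∀ x u n → proj₁ ((x , u) Dual-Exp.^ n) ≡ x ^ n
proj₁-^ x u zero    = ≡.refl
proj₁-^ x u (suc n) = ≡.cong (x *_) (proj₁-^ x u n)

proj₂-^ : ∀ x u n → proj₂ ((x , u) Dual-Exp.^ n) ≡ u * (fromℕ n * x ^ (n ∸ 1))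
proj₂-^ x u zero = solve 1 (λ u → con 0ℚ := u :* (con 0ℚ :* con 1ℚ)) ≡.refl u
  where open +-*-Solver
proj₂-^ x u (suc zero) = solve 2 (λ x u → x :* con 0ℚ :+ u :* con 1ℚ := u :* (con 1ℚ :* con 1ℚ)) ≡.refl x u
  where open +-*-Solver
-- Exponent 1 is separate because of the truncated `n ∸ 1`: here n = suc m, so x ^ n unfolds to x *
-- x ^ m.
proj₂-^ x u (suc n@(suc m)) = begin
  x * proj₂ ((x , u) Dual-Exp.^ n) + u * proj₁ ((x , u) Dual-Exp.^ n)
    ≡⟨ ≡.cong₂ (λ p q → x * p + u * q) (proj₂-^ x u n) (proj₁-^ x u n) ⟩
  x * (u * (fromℕ n * x ^ m)) + u * x ^ n
    ≡⟨ solve 4 (λ x u k z → x :* (u :* (k :* z)) :+ u :* (x :* z) := u :* ((con 1ℚ :+ k) :* (x :* z)))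
         ≡.refl x u (fromℕ n) (x ^ m) ⟩
  u * ((1ℚ + fromℕ n) * x ^ n)
    ≡⟨ ≡.cong (λ k → u * (k * x ^ n)) (fromℕ-suc n) ⟨
  u * (fromℕ (suc n) * x ^ n) ∎
  where
  open ≡.≡-Reasoning
  open +-*-Solver

-- First-order Taylor expansion: the ε-part at (x + uε, y + vε) is the derivative in direction (u ,
-- v). Reading off the ε-part of an identity on dual numbers therefore differentiates it.
proj₂-evalᴰ : ∀ P x u y v → proj₂ (evalᴰ P (x , u) (y , v)) ≡ u * eval (∂X P) x y + v * eval (∂Y P) x y
proj₂-evalᴰ [] x u y v = solve 2 (λ u v → con 0ℚ := u :* con 0ℚ :+ v :* con 0ℚ) ≡.refl u v
  where open +-*-Solver
proj₂-evalᴰ ((c X^ i Y^ j) ∷ P) x u y v = begin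
  c * (proj₁ xⁱ * proj₂ yʲ + proj₂ xⁱ * proj₁ yʲ) + 0ℚ * (proj₁ xⁱ * proj₁ yʲ) + proj₂ (evalᴰ P (x , u) (y , v))
    ≡⟨ ≡.cong₂ _+_
         (≡.cong₂ (λ (p , q) (r , s) → c * (p * s + q * r) + 0ℚ * (p * r))
           (≡.cong₂ _,_ (proj₁-^ x u i) (proj₂-^ x u i)) (≡.cong₂ _,_ (proj₁-^ y v j) (proj₂-^ y v j)))
         (proj₂-evalᴰ P x u y v) ⟩
  c * (x ^ i * (v * (fromℕ j * y ^ (j ∸ 1))) + u * (fromℕ i * x ^ (i ∸ 1)) * y ^ j) + 0ℚ * (x ^ i * y ^ j)
    + (u * eval (∂X P) x y + v * eval (∂Y P) x y)
    ≡⟨ solve 11 (λ c xi v fj yj′ u fi xi′ yj dx dy →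
         c :* (xi :* (v :* (fj :* yj′)) :+ u :* (fi :* xi′) :* yj) :+ con 0ℚ :* (xi :* yj) :+ (u :* dx :+ v :* dy)
         := u :* (fi :* c :* (xi′ :* yj) :+ dx) :+ v :* (fj :* c :* (xi :* yj′) :+ dy))
         ≡.refl c (x ^ i) v (fromℕ j) (y ^ (j ∸ 1)) u (fromℕ i) (x ^ (i ∸ 1)) (y ^ j) (eval (∂X P) x y) (eval (∂Y P) x y) ⟩
  u * eval (∂X ((c X^ i Y^ j) ∷ P)) x y + v * eval (∂Y ((c X^ i Y^ j) ∷ P)) x y ∎
  where
  open ≡.≡-Reasoning
  open +-*-Solver
  xⁱ = (x , u) Dual-Exp.^ i
  yʲ = (y , v) Dual-Exp.^ j

-- The chain rule: at the dual point (x + ε, y) the substituted argument X+Y takes the value (x + y)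
-- + ε, again with derivative 1.
eval-∂X-shift : ∀ P x y → eval (∂X (P ⟨ X ⊕ Y , Y ⟩)) x y ≡ eval (∂X P) (x + y) y
eval-∂X-shift P x y = begin
  eval (∂X Q) x y
    ≡⟨ solve 2 (λ f g → f := con 1ℚ :* f :+ con 0ℚ :* g) ≡.refl (eval (∂X Q) x y) (eval (∂Y Q) x y) ⟩
  1ℚ * eval (∂X Q) x y + 0ℚ * eval (∂Y Q) x y
    ≡⟨ proj₂-evalᴰ Q x 1ℚ y 0ℚ ⟨
  proj₂ (evalᴰ Q (x , 1ℚ) (y , 0ℚ))
    ≡⟨ proj₂ (Dual-Evaluation.eval-shift P (x , 1ℚ) (y , 0ℚ)) ⟩
  proj₂ (evalᴰ P (x + y , 1ℚ) (y , 0ℚ))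
    ≡⟨ proj₂-evalᴰ P (x + y) 1ℚ y 0ℚ ⟩
  1ℚ * eval (∂X P) (x + y) y + 0ℚ * eval (∂Y P) (x + y) y
    ≡⟨ solve 2 (λ f g → con 1ℚ :* f :+ con 0ℚ :* g := f) ≡.refl (eval (∂X P) (x + y) y) (eval (∂Y P) (x + y) y) ⟩
  eval (∂X P) (x + y) y ∎
  where
  open ≡.≡-Reasoning
  open +-*-Solver
  Q = P ⟨ X ⊕ Y , Y ⟩

-- F(-x,x+y) = F(x,y) for F(x,y) = G(x,y) - G(y,x).
PeriodRelation : (ℚ → ℚ → ℚ) → Set
PeriodRelation G = ∀ x y → G (- x) (x + y) - G (x + y) (- x) ≡ G x y - G y x

-x+[x+y]≡y : ∀ x y → - x + (x + y) ≡ y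
-x+[x+y]≡y = solve 2 (λ x y → :- x :+ (x :+ y) := y) ≡.refl
  where open +-*-Solver

[x+y]-x≡y : ∀ x y → (x + y) + - x ≡ y
[x+y]-x≡y = solve 2 (λ x y → (x :+ y) :+ :- x := y) ≡.refl
  where open +-*-Solver

-- Symmetric period polynomials

module _ {w P} (P∈W⁺ : W⁺ w P) where

  private
    h : ℚ → ℚ → ℚ
    h = eval P

    -- The factor y turns the exponent s - 2 of Type I into s - 1 = M - (r - 1), and the convention
    -- b = 0 at (2K , 1) becomes the absence of an x^M term.
    G : ℚ → ℚ → ℚ
    G x y = y * h (x + y) y

  -- The third summand p(y,-x) of the shifted relation is -p(x,y), by oddness and symmetry.
  W⁺-three-term : ∀ x y → h (x + y) y + h (x + y) x ≡ h x y
  W⁺-three-term x y = begin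
    h (x + y) y + h (x + y) x
      ≡⟨ solve 3 (λ a b c → a :+ b := (a :+ b :+ :- c) :+ c) ≡.refl (h (x + y) y) (h (x + y) x) (h x y) ⟩
    h (x + y) y + h (x + y) x + - h x y + h x y
      ≡⟨ ≡.cong₂ (λ b c → h (x + y) y + b + c + h x y)
           (ℚ-Evaluation.eval-symmetric P∈W⁺ x (x + y))
           (≡.trans (ℚ-Evaluation.eval-oddʳ P∈W⁺ y x) (≡.cong -_ (ℚ-Evaluation.eval-symmetric P∈W⁺ y x))) ⟨
    h (x + y) y + h x (x + y) + h y (- x) + h x y
      ≡⟨ ≡.cong (_+ h x y) (ℚ-Evaluation.eval-three-term′ (proj₁ P∈W⁺) x y) ⟩
    0ℚ + h x y
      ≡⟨ ℚ.+-identityˡ _ ⟩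
    h x y ∎
    where
    open ≡.≡-Reasoning
    open +-*-Solver

  -- With a = h(x+y,y) and b = h(x+y,x), the left side is (x+y) a - x h(x,y). Since h(x,y) = a + b,
  -- this is y a - x b.
  W⁺-periodRelation : PeriodRelation G
  W⁺-periodRelation x y = begin
    (x + y) * h (- x + (x + y)) (x + y) - (- x) * h ((x + y) + - x) (- x)
      ≡⟨ ≡.cong₂ (λ u v → (x + y) * u - (- x) * v)
           (≡.trans (≡.cong (λ z → h z (x + y)) (-x+[x+y]≡y x y)) (ℚ-Evaluation.eval-symmetric P∈W⁺ y (x + y)))
           (≡.trans (≡.cong (λ z → h z (- x)) ([x+y]-x≡y x y))
             (≡.trans (ℚ-Evaluation.eval-oddʳ P∈W⁺ y x) (≡.cong -_ (≡.trans (ℚ-Evaluation.eval-symmetric P∈W⁺ y x)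
               (≡.sym (W⁺-three-term x y)))))) ⟩
    (x + y) * h (x + y) y - (- x) * - (h (x + y) y + h (x + y) x)
      ≡⟨ solve 4 (λ x y a b → (x :+ y) :* a :- (:- x) :* (:- (a :+ b)) := y :* a :- x :* b)
           ≡.refl x y (h (x + y) y) (h (x + y) x) ⟩
    y * h (x + y) y - x * h (x + y) x
      ≡⟨ ≡.cong (λ z → y * h (x + y) y - x * h z x) (ℚ.+-comm x y) ⟩
    y * h (x + y) y - x * h (y + x) x ∎
    where
    open ≡.≡-Reasoning
    open +-*-Solver

  -- Both sides are zero: the left by its factor y, the right because `W⁺-three-term` at (1,0) reads
  -- h(1,0) + h(1,1) = h(1,0).
  W⁺-endpoints : G 1ℚ 0ℚ ≡ G 0ℚ 1ℚ
  W⁺-endpoints = begin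
    0ℚ * h 1ℚ 0ℚ          ≡⟨ ℚ.*-zeroˡ (h 1ℚ 0ℚ) ⟩
    0ℚ                    ≡⟨ solve 2 (λ a c → con 0ℚ := c :- c) ≡.refl (h 1ℚ 1ℚ) (h 1ℚ 0ℚ) ⟩
    h 1ℚ 0ℚ - h 1ℚ 0ℚ     ≡⟨ ≡.cong (_- h 1ℚ 0ℚ) (W⁺-three-term 1ℚ 0ℚ) ⟨
    h 1ℚ 0ℚ + h 1ℚ 1ℚ - h 1ℚ 0ℚ ≡⟨ solve 2 (λ a c → c :+ a :- c := con 1ℚ :* a) ≡.refl (h 1ℚ 1ℚ) (h 1ℚ 0ℚ) ⟩
    1ℚ * h 1ℚ 1ℚ ∎
    where
    open ≡.≡-Reasoning
    open +-*-Solver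

-- Antisymmetric period polynomials and their X-derivative

module _ {w P} (P∈W⁻ : W⁻ w P) where

  private
    f g : ℚ → ℚ → ℚ
    f = eval (∂X P)
    g = eval (∂Y P)

    G : ℚ → ℚ → ℚ
    G x y = f (x + y) y

  open +-*-Solver
  open ≡.≡-Reasoning

  -- Differentiating p(x,y) = -p(y,x) in y. This eliminates the Y-derivatives that the chain rule
  -- brings into the three-term relation.
  ∂Y-W⁻ : ∀ x y → g x y ≡ - f y x
  ∂Y-W⁻ x y = begin
    g x y
      ≡⟨ solve 2 (λ f g → g := con 0ℚ :* f :+ con 1ℚ :* g) ≡.refl (f x y) (g x y) ⟩
    0ℚ * f x y + 1ℚ * g x y
      ≡⟨ proj₂-evalᴰ P x 0ℚ y 1ℚ ⟨
    proj₂ (evalᴰ P (x , 0ℚ) (y , 1ℚ))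
      ≡⟨ proj₂ (Dual-Evaluation.eval-antisymmetric P∈W⁻ (x , 0ℚ) (y , 1ℚ)) ⟩
    - proj₂ (evalᴰ P (y , 1ℚ) (x , 0ℚ))
      ≡⟨ ≡.cong -_ (proj₂-evalᴰ P y 1ℚ x 0ℚ) ⟩
    - (1ℚ * f y x + 0ℚ * g y x)
      ≡⟨ solve 2 (λ f g → :- (con 1ℚ :* f :+ con 0ℚ :* g) := :- f) ≡.refl (f y x) (g y x) ⟩
    - f y x ∎

  ∂X-evenʳ : ∀ x y → f x (- y) ≡ f x y
  ∂X-evenʳ x y = begin
    f x (- y)
      ≡⟨ solve 2 (λ f g → f := con 1ℚ :* f :+ con 0ℚ :* g) ≡.refl (f x (- y)) (g x (- y)) ⟩
    1ℚ * f x (- y) + 0ℚ * g x (- y)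
      ≡⟨ proj₂-evalᴰ P x 1ℚ (- y) 0ℚ ⟨
    proj₂ (evalᴰ P (x , 1ℚ) (- y , 0ℚ))
      ≡⟨ proj₂ (Dual-Evaluation.eval-evenʳ P∈W⁻ (x , 1ℚ) (y , 0ℚ)) ⟩
    proj₂ (evalᴰ P (x , 1ℚ) (y , 0ℚ))
      ≡⟨ proj₂-evalᴰ P x 1ℚ y 0ℚ ⟩
    1ℚ * f x y + 0ℚ * g x y
      ≡⟨ solve 2 (λ f g → con 1ℚ :* f :+ con 0ℚ :* g := f) ≡.refl (f x y) (g x y) ⟩
    f x y ∎

  -- The dual point (x , 1) negates to (-x , -1): the direction changes sign as well, so the
  -- derivative of an even function is odd.
  ∂X-oddˡ : ∀ x y → f (- x) y ≡ - f x y
  ∂X-oddˡ x y = begin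
    f (- x) y
      ≡⟨ solve 2 (λ f g → f := :- (con (- 1ℚ) :* f :+ con 0ℚ :* g)) ≡.refl (f (- x) y) (g (- x) y) ⟩
    - (- 1ℚ * f (- x) y + 0ℚ * g (- x) y)
      ≡⟨ ≡.cong -_ (proj₂-evalᴰ P (- x) (- 1ℚ) y 0ℚ) ⟨
    - proj₂ (evalᴰ P (- x , - 1ℚ) (y , 0ℚ))
      ≡⟨ ≡.cong -_ (proj₂ (Dual-Evaluation.eval-evenˡ P∈W⁻ (x , 1ℚ) (y , 0ℚ))) ⟩
    - proj₂ (evalᴰ P (x , 1ℚ) (y , 0ℚ))
      ≡⟨ ≡.cong -_ (proj₂-evalᴰ P x 1ℚ y 0ℚ) ⟩
    - (1ℚ * f x y + 0ℚ * g x y)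
      ≡⟨ solve 2 (λ f g → :- (con 1ℚ :* f :+ con 0ℚ :* g) := :- f) ≡.refl (f x y) (g x y) ⟩
    - f x y ∎

  -- The X-derivative of p(X+Y,Y) + p(X,X+Y) + p(Y,-X) = 0.
  ∂X-three-term : ∀ x y → f (x + y) y + f x (x + y) ≡ f (x + y) x + f x y
  ∂X-three-term x y = begin
    f (x + y) y + f x (x + y)
      ≡⟨ solve 6 (λ a a′ b c c′ d →
           a :+ b := (con 1ℚ :* a :+ con 0ℚ :* a′) :+ (con 1ℚ :* b :+ con 1ℚ :* (:- c))
                     :+ (con 0ℚ :* c′ :+ con (- 1ℚ) :* (:- (:- d))) :+ (c :+ d))
           ≡.refl (f (x + y) y) (g (x + y) y) (f x (x + y)) (f (x + y) x) (f y (- x)) (f x y) ⟩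
    (1ℚ * f (x + y) y + 0ℚ * g (x + y) y) + (1ℚ * f x (x + y) + 1ℚ * - f (x + y) x)
      + (0ℚ * f y (- x) + - 1ℚ * - (- f x y)) + (f (x + y) x + f x y)
      ≡⟨ ≡.cong₂ (λ c d → (1ℚ * f (x + y) y + 0ℚ * g (x + y) y) + (1ℚ * f x (x + y) + 1ℚ * c)
           + (0ℚ * f y (- x) + - 1ℚ * d) + (f (x + y) x + f x y))
           (∂Y-W⁻ x (x + y)) (≡.trans (∂Y-W⁻ y (- x)) (≡.cong -_ (∂X-oddˡ x y))) ⟨
    (1ℚ * f (x + y) y + 0ℚ * g (x + y) y) + (1ℚ * f x (x + y) + 1ℚ * g x (x + y))
      + (0ℚ * f y (- x) + - 1ℚ * g y (- x)) + (f (x + y) x + f x y)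
      ≡⟨ ≡.cong (_+ (f (x + y) x + f x y)) (≡.cong₂ _+_ (≡.cong₂ _+_
           (proj₂-evalᴰ P (x + y) 1ℚ y 0ℚ) (proj₂-evalᴰ P x 1ℚ (x + y) 1ℚ)) (proj₂-evalᴰ P y 0ℚ (- x) (- 1ℚ))) ⟨
    proj₂ (evalᴰ P (x + y , 1ℚ) (y , 0ℚ)) + proj₂ (evalᴰ P (x , 1ℚ) (x + y , 1ℚ))
      + proj₂ (evalᴰ P (y , 0ℚ) (- x , - 1ℚ)) + (f (x + y) x + f x y)
      ≡⟨ ≡.cong (_+ (f (x + y) x + f x y))
           (proj₂ (Dual-Evaluation.eval-three-term′ (proj₁ P∈W⁻) (x , 1ℚ) (y , 0ℚ))) ⟩
    0ℚ + (f (x + y) x + f x y)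
      ≡⟨ ℚ.+-identityˡ _ ⟩
    f (x + y) x + f x y ∎

  -- By evenness in the second argument the left side is f(y,x+y) - f(y,x); exchanging x and y in
  -- `∂X-three-term` and rearranging gives f(x+y,y) - f(x+y,x).
  W⁻-periodRelation : PeriodRelation G
  W⁻-periodRelation x y = begin
    f (- x + (x + y)) (x + y) - f ((x + y) + - x) (- x)
      ≡⟨ ≡.cong₂ _-_ (≡.cong₂ f (-x+[x+y]≡y x y) (ℚ.+-comm x y))
           (≡.trans (≡.cong (λ z → f z (- x)) ([x+y]-x≡y x y)) (∂X-evenʳ y x)) ⟩
    f y (y + x) - f y x
      ≡⟨ solve 3 (λ a b c → b :- c := (a :+ b) :- (a :+ c)) ≡.refl (f (y + x) x) (f y (y + x)) (f y x) ⟩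
    (f (y + x) x + f y (y + x)) - (f (y + x) x + f y x)
      ≡⟨ ≡.cong (_- (f (y + x) x + f y x)) (∂X-three-term y x) ⟩
    (f (y + x) y + f y x) - (f (y + x) x + f y x)
      ≡⟨ solve 3 (λ a b c → (a :+ c) :- (b :+ c) := a :- b) ≡.refl (f (y + x) y) (f (y + x) x) (f y x) ⟩
    f (y + x) y - f (y + x) x
      ≡⟨ ≡.cong (λ z → f z y - f (y + x) x) (ℚ.+-comm y x) ⟩
    f (x + y) y - f (y + x) x ∎

  -- This is f(1,0) = f(1,1), from `∂X-three-term` at (0,1) after cancelling f(0,1). The common
  -- value can be nonzero: for p = Xⁿ - Yⁿ it is n.
  W⁻-endpoints : G 1ℚ 0ℚ ≡ G 0ℚ 1ℚ
  W⁻-endpoints = begin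
    f 1ℚ 0ℚ
      ≡⟨ solve 2 (λ a b → a := (a :+ b) :- b) ≡.refl (f 1ℚ 0ℚ) (f 0ℚ 1ℚ) ⟩
    (f 1ℚ 0ℚ + f 0ℚ 1ℚ) - f 0ℚ 1ℚ
      ≡⟨ ≡.cong (_- f 0ℚ 1ℚ) (≡.sym (∂X-three-term 0ℚ 1ℚ)) ⟩
    (f 1ℚ 1ℚ + f 0ℚ 1ℚ) - f 0ℚ 1ℚ
      ≡⟨ solve 2 (λ a b → (a :+ b) :- b := a) ≡.refl (f 1ℚ 1ℚ) (f 0ℚ 1ℚ) ⟩
    f 1ℚ 1ℚ ∎

-- Recovering coefficients from rational values

fromℕ-injective : ∀ {m n} → fromℕ m ≡ fromℕ n → m ≡ n
fromℕ-injective {m} {n} eq = ℤ.+-injective (ℤ.*-cancelʳ-≡ (ℤ.+ m) (ℤ.+ n) ℤ.1ℤ (ℚᵘ.drop-*≡* (begin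
  mkℚᵘ (ℤ.+ m) 0      ≈⟨ toℚᵘ-fromℕ m ⟨
  toℚᵘ (fromℕ m)      ≡⟨ ≡.cong toℚᵘ eq ⟩
  toℚᵘ (fromℕ n)      ≈⟨ toℚᵘ-fromℕ n ⟩
  mkℚᵘ (ℤ.+ n) 0      ∎)))
  where open ℚᵘ.≃-Reasoning

*-cancelˡ : ∀ {p q r} → p ≢ 0ℚ → p * q ≡ p * r → q ≡ r
*-cancelˡ {p} {q} {r} p≢0 pq≡pr = begin
  q                ≡⟨ cancel q ⟨
  1/ p * (p * q)   ≡⟨ ≡.cong (1/ p *_) pq≡pr ⟩
  1/ p * (p * r)   ≡⟨ cancel r ⟩
  r                ∎
  where
  open ≡.≡-Reasoning
  instance _ = ≢-nonZero p≢0
  cancel : ∀ q → 1/ p * (p * q) ≡ q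
  cancel q = ≡.trans (≡.sym (ℚ.*-assoc (1/ p) p q))
    (≡.trans (≡.cong (_* q) (ℚ.*-inverseˡ p)) (ℚ.*-identityˡ q))

*-zero-cancelˡ : ∀ {p q} → p ≢ 0ℚ → p * q ≡ 0ℚ → q ≡ 0ℚ
*-zero-cancelˡ {p} p≢0 pq≡0 = *-cancelˡ p≢0 (≡.trans pq≡0 (≡.sym (ℚ.*-zeroʳ p)))

1^n≡1 : ∀ n → 1ℚ ^ n ≡ 1ℚ
1^n≡1 zero    = ≡.refl
1^n≡1 (suc n) = ≡.trans (ℚ.*-identityˡ (1ℚ ^ n)) (1^n≡1 n)

fromℕ-^ : ∀ m n → fromℕ (m ℕ.^ n) ≡ fromℕ m ^ n
fromℕ-^ m zero    = ≡.refl
fromℕ-^ m (suc n) = ≡.trans (fromℕ-* m (m ℕ.^ n)) (≡.cong (fromℕ m *_) (fromℕ-^ m n))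

2ℚ : ℚ
2ℚ = fromℕ 2

2^[1+n]≢1 : ∀ n → 2ℚ ^ suc n ≢ 1ℚ
2^[1+n]≢1 n eq = impossible (ℕ.m^n≡1⇒n≡0∨m≡1 2 (suc n) 2^[1+n]≡1)
  where
  2^[1+n]≡1 : 2 ℕ.^ suc n ≡ 1
  2^[1+n]≡1 = fromℕ-injective {2 ℕ.^ suc n} {1} (≡.trans (fromℕ-^ 2 (suc n)) eq)
  impossible : suc n ≡ 0 ⊎ 2 ≡ 1 → ⊥
  impossible (inj₁ ())
  impossible (inj₂ ())

-- If f(x) = c₀ + x h(x) vanishes for x ≠ 0, then so does
-- (f(2x) - f(x)) / x = 2 h(2x) - h(x), whose coefficients are (2ⁱ⁺¹ - 1) cᵢ₊₁.
vanishing-polynomial : ∀ n (c : ℕ → ℚ) →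
  (∀ x → x ≢ 0ℚ → ∑[ i < n ] (c (toℕ i) * x ^ toℕ i) ≡ 0ℚ) →
  ∀ i → i ℕ.< n → c i ≡ 0ℚ
vanishing-polynomial (suc n) c vanishes = coefficient
  where
  open ≡.≡-Reasoning
  open +-*-Solver

  f : ℚ → ℚ
  f x = ∑[ i < suc n ] (c (toℕ i) * x ^ toℕ i)

  c′ : ℕ → ℚ
  c′ i = (2ℚ ^ suc i - 1ℚ) * c (suc i)

  2x≢0 : ∀ {x} → x ≢ 0ℚ → 2ℚ * x ≢ 0ℚ
  2x≢0 {x} x≢0 2x≡0 = x≢0 (*-zero-cancelˡ {2ℚ} {x} (λ ()) 2x≡0)

  difference : ∀ x → x * ∑[ i < n ] (c′ (toℕ i) * x ^ toℕ i) + f x ≡ f (2ℚ * x)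
  difference x = begin
    x * ∑[ i < n ] (c′ (toℕ i) * x ^ toℕ i) + (c 0 * 1ℚ + ∑[ i < n ] (c (suc (toℕ i)) * x ^ suc (toℕ i)))
      ≡⟨ solve 4 (λ x s d t → x :* s :+ (d :+ t) := d :+ (x :* s :+ t)) ≡.refl x
           (∑[ i < n ] (c′ (toℕ i) * x ^ toℕ i)) (c 0 * 1ℚ) (∑[ i < n ] (c (suc (toℕ i)) * x ^ suc (toℕ i))) ⟩
    c 0 * 1ℚ + (x * ∑[ i < n ] (c′ (toℕ i) * x ^ toℕ i) + ∑[ i < n ] (c (suc (toℕ i)) * x ^ suc (toℕ i)))
      ≡⟨ ≡.cong (λ s → c 0 * 1ℚ + (s + ∑[ i < n ] (c (suc (toℕ i)) * x ^ suc (toℕ i))))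
           (*-distribˡ-sum {n} x (λ i → c′ (toℕ i) * x ^ toℕ i)) ⟩
    c 0 * 1ℚ + (∑[ i < n ] (x * (c′ (toℕ i) * x ^ toℕ i)) + ∑[ i < n ] (c (suc (toℕ i)) * x ^ suc (toℕ i)))
      ≡⟨ ≡.cong (c 0 * 1ℚ +_)
           (∑-distrib-+ {n} (λ i → x * (c′ (toℕ i) * x ^ toℕ i)) (λ i → c (suc (toℕ i)) * x ^ suc (toℕ i))) ⟨
    c 0 * 1ℚ + ∑[ i < n ] (x * (c′ (toℕ i) * x ^ toℕ i) + c (suc (toℕ i)) * x ^ suc (toℕ i))
      ≡⟨ ≡.cong (c 0 * 1ℚ +_) (sum-cong-≗ {n} λ i → termwise (toℕ i)) ⟩
    c 0 * 1ℚ + ∑[ i < n ] (c (suc (toℕ i)) * (2ℚ * x) ^ suc (toℕ i)) ∎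
    where
    termwise : ∀ i → x * (c′ i * x ^ i) + c (suc i) * x ^ suc i ≡ c (suc i) * (2ℚ * x) ^ suc i
    termwise i = begin
      x * ((2ℚ ^ suc i - 1ℚ) * c (suc i) * x ^ i) + c (suc i) * x ^ suc i
        ≡⟨ solve 4 (λ x t c z → x :* ((t :- con 1ℚ) :* c :* z) :+ c :* (x :* z) := c :* (t :* (x :* z)))
             ≡.refl x (2ℚ ^ suc i) (c (suc i)) (x ^ i) ⟩
      c (suc i) * (2ℚ ^ suc i * x ^ suc i)
        ≡⟨ ≡.cong (c (suc i) *_) (^-distrib-* 2ℚ x (suc i)) ⟨
      c (suc i) * (2ℚ * x) ^ suc i ∎

  c′≡0 : ∀ i → i ℕ.< n → c′ i ≡ 0ℚ
  c′≡0 = vanishing-polynomial n c′ λ x x≢0 → *-zero-cancelˡ x≢0 (begin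
    x * ∑[ i < n ] (c′ (toℕ i) * x ^ toℕ i)          ≡⟨ ℚ.+-identityʳ (x * ∑[ i < n ] (c′ (toℕ i) * x ^ toℕ i)) ⟨
    x * ∑[ i < n ] (c′ (toℕ i) * x ^ toℕ i) + 0ℚ     ≡⟨ ≡.cong (x * ∑[ i < n ] (c′ (toℕ i) * x ^ toℕ i) +_) (vanishes x x≢0) ⟨
    x * ∑[ i < n ] (c′ (toℕ i) * x ^ toℕ i) + f x    ≡⟨ difference x ⟩
    f (2ℚ * x)                                       ≡⟨ vanishes (2ℚ * x) (2x≢0 x≢0) ⟩
    0ℚ                                               ∎)

  c[1+i]≡0 : ∀ i → i ℕ.< n → c (suc i) ≡ 0ℚ
  c[1+i]≡0 i i<n = *-zero-cancelˡ {2ℚ ^ suc i - 1ℚ}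
    (λ eq → 2^[1+n]≢1 i (≡.trans (solve 1 (λ t → t := (t :- con 1ℚ) :+ con 1ℚ) ≡.refl (2ℚ ^ suc i)) (≡.cong (_+ 1ℚ) eq)))
    (c′≡0 i i<n)

  coefficient : ∀ i → i ℕ.< suc n → c i ≡ 0ℚ
  -- The hypothesis says nothing at 0, so c₀ is read off at x = 1, where the other terms are already
  -- known to vanish.
  coefficient zero    _           = begin
    c 0                     ≡⟨ solve 1 (λ c → c := c :* con 1ℚ :+ con 0ℚ) ≡.refl (c 0) ⟩
    c 0 * 1ℚ + 0ℚ           ≡⟨ ≡.cong (c 0 * 1ℚ +_) (∑-zero n (λ i → c (suc (toℕ i)) * 1ℚ ^ suc (toℕ i)) λ i →
                                 ≡.trans (≡.cong (_* 1ℚ ^ suc (toℕ i)) (c[1+i]≡0 (toℕ i) (Fin.toℕ<n i))) (ℚ.*-zeroˡ (1ℚ ^ suc (toℕ i)))) ⟨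
    f 1ℚ                    ≡⟨ vanishes 1ℚ (λ ()) ⟩
    0ℚ                      ∎
  coefficient (suc i) (ℕ.s≤s i<n) = c[1+i]≡0 i i<n

-- Binomial identities

[1+k]*[1+n]C[1+k] : ∀ n k → suc k ℕ.* (suc n C suc k) ≡ suc n ℕ.* (n C k)
[1+k]*[1+n]C[1+k] zero    zero    = ≡.refl
[1+k]*[1+n]C[1+k] zero    (suc k) = ≡.trans
  (≡.cong (suc (suc k) ℕ.*_) (k>n⇒nCk≡0 {1} {suc (suc k)} (ℕ.s≤s (ℕ.s≤s ℕ.z≤n)))) (ℕ.*-zeroʳ (suc (suc k)))
[1+k]*[1+n]C[1+k] (suc n) zero    = begin
  1 ℕ.* (suc (suc n) C 1)    ≡⟨ ≡.cong (1 ℕ.*_) (nC1≡n (suc (suc n))) ⟩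
  1 ℕ.* suc (suc n)          ≡⟨ ℕ.*-comm 1 (suc (suc n)) ⟩
  suc (suc n) ℕ.* 1          ∎
  where open ≡.≡-Reasoning
[1+k]*[1+n]C[1+k] (suc n) (suc k) = begin
  (2 ℕ.+ k) ℕ.* (suc (suc n) C suc (suc k))
    ≡⟨ ≡.cong ((2 ℕ.+ k) ℕ.*_) (nCk+nC[k+1]≡[n+1]C[k+1] (suc n) (suc k)) ⟨
  (2 ℕ.+ k) ℕ.* (A ℕ.+ (suc n C suc (suc k)))
    ≡⟨ expand k A (suc n C suc (suc k)) ⟩
  A ℕ.+ (suc k ℕ.* A ℕ.+ (2 ℕ.+ k) ℕ.* (suc n C suc (suc k)))
    ≡⟨ ≡.cong (A ℕ.+_) (≡.cong₂ ℕ._+_ ([1+k]*[1+n]C[1+k] n k) ([1+k]*[1+n]C[1+k] n (suc k))) ⟩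
  A ℕ.+ (suc n ℕ.* (n C k) ℕ.+ suc n ℕ.* (n C suc k))
    ≡⟨ ≡.cong (A ℕ.+_) (ℕ.*-distribˡ-+ (suc n) (n C k) (n C suc k)) ⟨
  A ℕ.+ suc n ℕ.* ((n C k) ℕ.+ (n C suc k))
    ≡⟨ ≡.cong (λ z → A ℕ.+ suc n ℕ.* z) (nCk+nC[k+1]≡[n+1]C[k+1] n k) ⟩
  (2 ℕ.+ n) ℕ.* A ∎
  where
  open ≡.≡-Reasoning
  A = suc n C suc k
  expand : ∀ k a b → (2 ℕ.+ k) ℕ.* (a ℕ.+ b) ≡ a ℕ.+ (suc k ℕ.* a ℕ.+ (2 ℕ.+ k) ℕ.* b)
  expand = ℕSolver.solve-∀

nCk≢0 : ∀ {n k} → k ℕ.≤ n → n C k ≢ 0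
nCk≢0 {n}     {zero}  _           ()
nCk≢0 {suc n} {suc k} (ℕ.s≤s k≤n) eq =
  nCk≢0 k≤n (ℕ.m+n≡0⇒m≡0 (n C k) (≡.trans (nCk+nC[k+1]≡[n+1]C[k+1] n k) eq))

binom≢0 : ∀ {n k} → k ℕ.≤ n → binom n k ≢ 0ℚ
binom≢0 {n} {k} k≤n eq = nCk≢0 k≤n (fromℕ-injective {n C k} {0} eq)

binom-absorption : ∀ n k → fromℕ (suc k) * binom (suc n) (suc k) ≡ fromℕ (suc n) * binom n k
binom-absorption n k = ≡.trans (≡.sym (fromℕ-* (suc k) (suc n C suc k)))
  (≡.trans (≡.cong fromℕ ([1+k]*[1+n]C[1+k] n k)) (fromℕ-* (suc n) (n C k)))

×-fromℕ : ∀ n x → Mult._×_ ℚ-Ring.semiring n x ≡ fromℕ n * x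
×-fromℕ zero    x = ≡.sym (ℚ.*-zeroˡ x)
×-fromℕ (suc n) x = begin
  x + Mult._×_ ℚ-Ring.semiring n x ≡⟨ ≡.cong (x +_) (×-fromℕ n x) ⟩
  x + fromℕ n * x             ≡⟨ solve 2 (λ x n → x :+ n :* x := (con 1ℚ :+ n) :* x) ≡.refl x (fromℕ n) ⟩
  (1ℚ + fromℕ n) * x          ≡⟨ ≡.cong (_* x) (fromℕ-suc n) ⟨
  fromℕ (suc n) * x           ∎
  where
  open ≡.≡-Reasoning
  open +-*-Solver

binomial-theorem : ∀ n x → (x + 1ℚ) ^ n ≡ ∑[ k < suc n ] (binom n (toℕ k) * x ^ toℕ k)
binomial-theorem n x = ≡.trans (Binomial.theorem ℚ-Ring.commutativeSemiring n x 1ℚ)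
  (sum-cong-≗ {suc n} λ k → ≡.trans (×-fromℕ (n C toℕ k) (x ^ toℕ k * 1ℚ ^ (n ∸ toℕ k)))
    (≡.cong (binom n (toℕ k) *_) (≡.trans (≡.cong (x ^ toℕ k *_) (1^n≡1 (n ∸ toℕ k))) (ℚ.*-identityʳ (x ^ toℕ k)))))

-- Rests on C(N,a) C(N-a,n-a) = C(N,n) C(n,a) with N = a + m. In the form C(N,n) C(n,a) no shifted
-- index is needed, as the terms with n < a vanish, and the factor C(N,n) does not depend on a.
binomial-expansion : ∀ a m x →
  binom (a ℕ.+ m) a * (x ^ a * (x + 1ℚ) ^ m) ≡
  ∑[ n < suc (a ℕ.+ m) ] (binom (a ℕ.+ m) (toℕ n) * binom (toℕ n) a * x ^ toℕ n)
binomial-expansion zero m x = begin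
  1ℚ * (1ℚ * (x + 1ℚ) ^ m)
    ≡⟨ ≡.trans (ℚ.*-identityˡ (1ℚ * (x + 1ℚ) ^ m)) (ℚ.*-identityˡ ((x + 1ℚ) ^ m)) ⟩
  (x + 1ℚ) ^ m
    ≡⟨ binomial-theorem m x ⟩
  ∑[ n < suc m ] (binom m (toℕ n) * x ^ toℕ n)
    ≡⟨ (sum-cong-≗ {suc m} λ n → ≡.cong (_* x ^ toℕ n) (ℚ.*-identityʳ (binom m (toℕ n)))) ⟨
  ∑[ n < suc m ] (binom m (toℕ n) * 1ℚ * x ^ toℕ n) ∎
  where open ≡.≡-Reasoning
-- After multiplication by s = a + 1, absorption lowers C(N+1,a+1) to C(N,a) for the induction
-- hypothesis; `termwise` then uses absorption twice to raise both binomials under the sum, which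
-- releases the factor s again.
binomial-expansion (suc a) m x = *-cancelˡ {s} s≢0 (begin
  s * (binom (suc N) (suc a) * (x * x ^ a * z))
    ≡⟨ solve 5 (λ s b x xa z → s :* (b :* (x :* xa :* z)) := (s :* b) :* (x :* (xa :* z)))
         ≡.refl s (binom (suc N) (suc a)) x (x ^ a) z ⟩
  (s * binom (suc N) (suc a)) * (x * (x ^ a * z))
    ≡⟨ ≡.cong (_* (x * (x ^ a * z))) (binom-absorption N a) ⟩
  (t * binom N a) * (x * (x ^ a * z))
    ≡⟨ solve 4 (λ t b x w → (t :* b) :* (x :* w) := (t :* x) :* (b :* w)) ≡.refl t (binom N a) x (x ^ a * z) ⟩
  (t * x) * (binom N a * (x ^ a * z))
    ≡⟨ ≡.cong ((t * x) *_) (binomial-expansion a m x) ⟩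
  (t * x) * ∑[ n < suc N ] (binom N (toℕ n) * binom (toℕ n) a * x ^ toℕ n)
    ≡⟨ *-distribˡ-sum {suc N} (t * x) (λ n → binom N (toℕ n) * binom (toℕ n) a * x ^ toℕ n) ⟩
  ∑[ n < suc N ] (t * x * (binom N (toℕ n) * binom (toℕ n) a * x ^ toℕ n))
    ≡⟨ (sum-cong-≗ {suc N} λ n → termwise (toℕ n)) ⟩
  ∑[ n < suc N ] (s * summand (suc (toℕ n)))
    ≡⟨ *-distribˡ-sum {suc N} s (λ n → summand (suc (toℕ n))) ⟨
  s * ∑[ n < suc N ] summand (suc (toℕ n))
    -- The index has moved from n to n + 1; the term now missing at 0 contains C(0,a+1) = 0.
    ≡⟨ ≡.cong (s *_) (≡.trans (≡.cong (_+ ∑[ n < suc N ] summand (suc (toℕ n))) summand-zero) (ℚ.+-identityˡ (∑[ n < suc N ] summand (suc (toℕ n))))) ⟨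
  s * ∑[ n < suc (suc N) ] summand (toℕ n) ∎)
  where
  open ≡.≡-Reasoning
  open +-*-Solver
  N = a ℕ.+ m
  s = fromℕ (suc a)
  t = fromℕ (suc N)
  z = (x + 1ℚ) ^ m
  s≢0 : s ≢ 0ℚ
  s≢0 eq = ℕ.1+n≢0 (fromℕ-injective {suc a} {0} eq)
  summand : ℕ → ℚ
  summand n = binom (suc N) n * binom n (suc a) * x ^ n
  summand-zero : summand 0 ≡ 0ℚ
  summand-zero = ≡.trans (≡.cong (_* 1ℚ) (ℚ.*-zeroʳ (binom (suc N) 0))) (ℚ.*-zeroˡ 1ℚ)
  termwise : ∀ n → t * x * (binom N n * binom n a * x ^ n) ≡ s * summand (suc n)
  termwise n = begin
    t * x * (binom N n * binom n a * x ^ n)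
      ≡⟨ solve 5 (λ t x b c y → t :* x :* (b :* c :* y) := (t :* b) :* (c :* (x :* y)))
           ≡.refl t x (binom N n) (binom n a) (x ^ n) ⟩
    (t * binom N n) * (binom n a * (x * x ^ n))
      ≡⟨ ≡.cong (_* (binom n a * (x * x ^ n))) (binom-absorption N n) ⟨
    (fromℕ (suc n) * binom (suc N) (suc n)) * (binom n a * (x * x ^ n))
      ≡⟨ solve 4 (λ k b c y → (k :* b) :* (c :* y) := (k :* c) :* (b :* y))
           ≡.refl (fromℕ (suc n)) (binom (suc N) (suc n)) (binom n a) (x * x ^ n) ⟩
    (fromℕ (suc n) * binom n a) * (binom (suc N) (suc n) * (x * x ^ n))
      ≡⟨ ≡.cong (_* (binom (suc N) (suc n) * (x * x ^ n))) (binom-absorption n a) ⟨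
    (s * binom (suc n) (suc a)) * (binom (suc N) (suc n) * (x * x ^ n))
      ≡⟨ solve 4 (λ s b c y → (s :* b) :* (c :* y) := s :* (c :* b :* y))
           ≡.refl s (binom (suc n) (suc a)) (binom (suc N) (suc n)) (x * x ^ n) ⟩
    s * summand (suc n) ∎

-- Signs and reindexing of finite sums

-1^ : ℕ → ℚ
-1^ n = (- 1ℚ) ^ n

[-x]^n : ∀ x n → (- x) ^ n ≡ -1^ n * x ^ n
[-x]^n x n = ≡.trans (≡.cong (_^ n) (solve 1 (λ x → :- x := con (- 1ℚ) :* x) ≡.refl x)) (^-distrib-* (- 1ℚ) x n)
  where open +-*-Solver

-1^[i*2]≡1 : ∀ i → -1^ (i ℕ.* 2) ≡ 1ℚ
-1^[i*2]≡1 zero    = ≡.refl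
-1^[i*2]≡1 (suc i) = ≡.cong (λ z → - 1ℚ * (- 1ℚ * z)) (-1^[i*2]≡1 i)

∑-reverse : ∀ n (f : ℕ → ℚ) → ∑[ i < suc n ] f (toℕ i) ≡ ∑[ i < suc n ] f (n ∸ toℕ i)
∑-reverse n f = ≡.trans (sum-permute {suc n} (λ i → f (toℕ i)) reverse)
  (sum-cong-≗ {suc n} λ i → ≡.cong f (Fin.opposite-prop i))

∑-last : ∀ n (f : ℕ → ℚ) → ∑[ i < suc n ] f (toℕ i) ≡ ∑[ i < n ] f (toℕ i) + f n
∑-last zero    f = ℚ.+-comm (f 0) 0ℚ
∑-last (suc n) f = ≡.trans (≡.cong (f 0 +_) (∑-last n (λ i → f (suc i))))
  (≡.sym (ℚ.+-assoc (f 0) (∑[ i < n ] f (suc (toℕ i))) (f (suc n))))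

∑-pairs : ∀ n (f : ℕ → ℚ) →
  ∑[ a < n ℕ.* 2 ] f (toℕ a) ≡ ∑[ i < n ] (f (toℕ i ℕ.* 2) + f (suc (toℕ i ℕ.* 2)))
∑-pairs zero    f = ≡.refl
∑-pairs (suc n) f = ≡.trans
  (≡.cong (λ s → f 0 + (f 1 + s)) (∑-pairs n (λ a → f (suc (suc a)))))
  (≡.sym (ℚ.+-assoc (f 0) (f 1) (∑[ i < n ] (f (suc (suc (toℕ i ℕ.* 2))) + f (suc (suc (suc (toℕ i ℕ.* 2))))))))

-- Antisymmetrisation and the signed binomial transform

module Antisymmetrisation (M : ℕ) (β : ℕ → ℚ) where

  open ≡.≡-Reasoning
  open +-*-Solver

  G F : ℚ → ℚ → ℚ
  -- `transform` is the signed binomial transform of D. Summing up to M instead of n only adds zeros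
  -- when n ≤ M, and makes the range independent of n, so that sums can be exchanged.
  D transform : ℕ → ℚ

  G x y = ∑[ a < suc M ] (binom M (toℕ a) * β (toℕ a) * (x ^ toℕ a * y ^ (M ∸ toℕ a)))
  D a = β a - β (M ∸ a)
  F x y = ∑[ a < suc M ] (binom M (toℕ a) * D (toℕ a) * (x ^ toℕ a * y ^ (M ∸ toℕ a)))
  transform n = ∑[ a < suc M ] (-1^ (toℕ a) * binom n (toℕ a) * D (toℕ a))

  D-antisymmetric : ∀ {a} → a ℕ.≤ M → D (M ∸ a) ≡ - D a
  D-antisymmetric {a} a≤M = begin
    β (M ∸ a) - β (M ∸ (M ∸ a)) ≡⟨ ≡.cong (λ b → β (M ∸ a) - β b) (ℕ.m∸[m∸n]≡n a≤M) ⟩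
    β (M ∸ a) - β a             ≡⟨ solve 2 (λ p q → p :- q := :- (q :- p)) ≡.refl (β (M ∸ a)) (β a) ⟩
    - D a                       ∎

  -- Reversing a to M - a in G(y,x) and using C(M,a) = C(M,M-a) gives the coefficients β(M-a). The
  -- additive form lets the two sums be merged termwise.
  F+Gᵒᵖ≡G : ∀ x y → F x y + G y x ≡ G x y
  F+Gᵒᵖ≡G x y = begin
    F x y + G y x
      ≡⟨ ≡.cong (F x y +_) (≡.trans (∑-reverse M (λ a → binom M a * β a * (y ^ a * x ^ (M ∸ a))))
           (sum-cong-≗ {suc M} λ a → reflect (ℕ.s≤s⁻¹ (Fin.toℕ<n a)))) ⟩
    F x y + ∑[ a < suc M ] (binom M (toℕ a) * β (M ∸ toℕ a) * (x ^ toℕ a * y ^ (M ∸ toℕ a)))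
      ≡⟨ ∑-distrib-+ {suc M} (λ a → binom M (toℕ a) * D (toℕ a) * (x ^ toℕ a * y ^ (M ∸ toℕ a)))
           (λ a → binom M (toℕ a) * β (M ∸ toℕ a) * (x ^ toℕ a * y ^ (M ∸ toℕ a))) ⟨
    ∑[ a < suc M ] (binom M (toℕ a) * D (toℕ a) * (x ^ toℕ a * y ^ (M ∸ toℕ a))
                    + binom M (toℕ a) * β (M ∸ toℕ a) * (x ^ toℕ a * y ^ (M ∸ toℕ a)))
      ≡⟨ (sum-cong-≗ {suc M} λ a → solve 4 (λ c p q z → c :* (p :- q) :* z :+ c :* q :* z := c :* p :* z) ≡.refl
           (binom M (toℕ a)) (β (toℕ a)) (β (M ∸ toℕ a)) (x ^ toℕ a * y ^ (M ∸ toℕ a))) ⟩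
    G x y ∎
    where
    reflect : ∀ {a} → a ℕ.≤ M →
      binom M (M ∸ a) * β (M ∸ a) * (y ^ (M ∸ a) * x ^ (M ∸ (M ∸ a))) ≡ binom M a * β (M ∸ a) * (x ^ a * y ^ (M ∸ a))
    reflect {a} a≤M = ≡.cong₂ (λ c z → c * β (M ∸ a) * z)
      (≡.cong fromℕ (≡.sym (nCk≡nC[n∸k] a≤M)))
      (≡.trans (≡.cong (λ b → y ^ (M ∸ a) * x ^ b) (ℕ.m∸[m∸n]≡n a≤M)) (ℚ.*-comm (y ^ (M ∸ a)) (x ^ a)))

  F≡G-Gᵒᵖ : ∀ x y → F x y ≡ G x y - G y x
  F≡G-Gᵒᵖ x y = ≡.trans (solve 2 (λ f g → f := (f :+ g) :- g) ≡.refl (F x y) (G y x))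
    (≡.cong (_- G y x) (F+Gᵒᵖ≡G x y))

  -- At (0,1) only the term a = 0 survives, so F(0,1) is D 0.
  D[0]≡0 : G 1ℚ 0ℚ ≡ G 0ℚ 1ℚ → D 0 ≡ 0ℚ
  D[0]≡0 endpoints = begin
    D 0
      ≡⟨ solve 1 (λ d → d := con 1ℚ :* d :* (con 1ℚ :* con 1ℚ) :+ con 0ℚ) ≡.refl (D 0) ⟩
    1ℚ * D 0 * (1ℚ * 1ℚ) + 0ℚ
      ≡⟨ ≡.cong₂ (λ p q → 1ℚ * D 0 * (1ℚ * p) + q) (1^n≡1 M)
           (∑-zero M (λ a → binom M (suc (toℕ a)) * D (suc (toℕ a)) * (0ℚ ^ suc (toℕ a) * 1ℚ ^ (M ∸ suc (toℕ a)))) λ a →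
             solve 4 (λ c d z w → c :* d :* (con 0ℚ :* z :* w) := con 0ℚ) ≡.refl
               (binom M (suc (toℕ a))) (D (suc (toℕ a))) (0ℚ ^ toℕ a) (1ℚ ^ (M ∸ suc (toℕ a)))) ⟨
    F 0ℚ 1ℚ
      ≡⟨ F≡G-Gᵒᵖ 0ℚ 1ℚ ⟩
    G 0ℚ 1ℚ - G 1ℚ 0ℚ
      ≡⟨ ≡.cong (λ z → G 0ℚ 1ℚ - z) endpoints ⟩
    G 0ℚ 1ℚ - G 0ℚ 1ℚ
      ≡⟨ ℚ.+-inverseʳ (G 0ℚ 1ℚ) ⟩
    0ℚ ∎

  F[x,1] : ∀ x → F x 1ℚ ≡ ∑[ n < suc M ] (binom M (toℕ n) * D (toℕ n) * x ^ toℕ n)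
  F[x,1] x = sum-cong-≗ {suc M} λ n → ≡.cong (binom M (toℕ n) * D (toℕ n) *_)
    (≡.trans (≡.cong (x ^ toℕ n *_) (1^n≡1 (M ∸ toℕ n))) (ℚ.*-identityʳ (x ^ toℕ n)))

  -- By `binomial-expansion` the term with index a contributes C(M,n) C(n,a) (-1)ᵃ D a to the
  -- coefficient of xⁿ; after exchanging the sums, C(M,n) factors out.
  F[-x,x+1] : ∀ x → F (- x) (x + 1ℚ) ≡ ∑[ n < suc M ] (binom M (toℕ n) * transform (toℕ n) * x ^ toℕ n)
  F[-x,x+1] x = begin
    F (- x) (x + 1ℚ)
      ≡⟨ (sum-cong-≗ {suc M} λ a → expand (ℕ.s≤s⁻¹ (Fin.toℕ<n a))) ⟩
    ∑[ a < suc M ] ∑[ n < suc M ] summand (toℕ a) (toℕ n)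
      ≡⟨ ∑-comm {suc M} {suc M} (λ a n → summand (toℕ a) (toℕ n)) ⟩
    ∑[ n < suc M ] ∑[ a < suc M ] summand (toℕ a) (toℕ n)
      ≡⟨ (sum-cong-≗ {suc M} λ n → collect (toℕ n)) ⟩
    ∑[ n < suc M ] (binom M (toℕ n) * transform (toℕ n) * x ^ toℕ n) ∎
    where
    summand : ℕ → ℕ → ℚ
    summand a n = D a * -1^ a * (binom M n * binom n a * x ^ n)

    binomial-expansion′ : ∀ {a} → a ℕ.≤ M →
      binom M a * (x ^ a * (x + 1ℚ) ^ (M ∸ a)) ≡ ∑[ n < suc M ] (binom M (toℕ n) * binom (toℕ n) a * x ^ toℕ n)
    binomial-expansion′ {a} a≤M = ≡.subst
      (λ N → binom N a * (x ^ a * (x + 1ℚ) ^ (M ∸ a)) ≡ ∑[ n < suc N ] (binom N (toℕ n) * binom (toℕ n) a * x ^ toℕ n))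
      (ℕ.m+[n∸m]≡n a≤M) (binomial-expansion a (M ∸ a) x)

    expand : ∀ {a} → a ℕ.≤ M →
      binom M a * D a * ((- x) ^ a * (x + 1ℚ) ^ (M ∸ a)) ≡ ∑[ n < suc M ] summand a (toℕ n)
    expand {a} a≤M = begin
      binom M a * D a * ((- x) ^ a * (x + 1ℚ) ^ (M ∸ a))
        ≡⟨ ≡.cong (λ z → binom M a * D a * (z * (x + 1ℚ) ^ (M ∸ a))) ([-x]^n x a) ⟩
      binom M a * D a * (-1^ a * x ^ a * (x + 1ℚ) ^ (M ∸ a))
        ≡⟨ solve 5 (λ c d s p q → c :* d :* (s :* p :* q) := d :* s :* (c :* (p :* q)))
             ≡.refl (binom M a) (D a) (-1^ a) (x ^ a) ((x + 1ℚ) ^ (M ∸ a)) ⟩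
      D a * -1^ a * (binom M a * (x ^ a * (x + 1ℚ) ^ (M ∸ a)))
        ≡⟨ ≡.cong (D a * -1^ a *_) (binomial-expansion′ a≤M) ⟩
      D a * -1^ a * ∑[ n < suc M ] (binom M (toℕ n) * binom (toℕ n) a * x ^ toℕ n)
        ≡⟨ *-distribˡ-sum {suc M} (D a * -1^ a) (λ n → binom M (toℕ n) * binom (toℕ n) a * x ^ toℕ n) ⟩
      ∑[ n < suc M ] summand a (toℕ n) ∎

    collect : ∀ n → ∑[ a < suc M ] summand (toℕ a) n ≡ binom M n * transform n * x ^ n
    collect n = begin
      ∑[ a < suc M ] summand (toℕ a) n
        ≡⟨ (sum-cong-≗ {suc M} λ a → solve 5 (λ d s c e p → d :* s :* (c :* e :* p) := c :* p :* (s :* e :* d))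
             ≡.refl (D (toℕ a)) (-1^ (toℕ a)) (binom M n) (binom n (toℕ a)) (x ^ n)) ⟩
      ∑[ a < suc M ] (binom M n * x ^ n * (-1^ (toℕ a) * binom n (toℕ a) * D (toℕ a)))
        ≡⟨ *-distribˡ-sum {suc M} (binom M n * x ^ n) (λ a → -1^ (toℕ a) * binom n (toℕ a) * D (toℕ a)) ⟨
      binom M n * x ^ n * transform n
        ≡⟨ solve 3 (λ c p t → c :* p :* t := c :* t :* p) ≡.refl (binom M n) (x ^ n) (transform n) ⟩
      binom M n * transform n * x ^ n ∎

  -- The polynomial F(-x,x+1) - F(x,1) has coefficients C(M,n) (transform n - D n), and n ≤ M makes
  -- C(M,n) cancellable.
  transform-fixes-D : PeriodRelation G → ∀ {n} → n ℕ.≤ M → transform n ≡ D n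
  transform-fixes-D relation {n} n≤M = begin
    transform n
      ≡⟨ solve 2 (λ t d → t := (t :- d) :+ d) ≡.refl (transform n) (D n) ⟩
    transform n - D n + D n
      ≡⟨ ≡.cong (_+ D n) (*-zero-cancelˡ {binom M n} {transform n - D n} (binom≢0 n≤M)
           (vanishing-polynomial (suc M) coefficient (λ x _ → vanishes x) n (ℕ.s≤s n≤M))) ⟩
    0ℚ + D n
      ≡⟨ ℚ.+-identityˡ (D n) ⟩
    D n ∎
    where
    coefficient : ℕ → ℚ
    coefficient n = binom M n * (transform n - D n)

    F-relation : ∀ x → F (- x) (x + 1ℚ) ≡ F x 1ℚ
    F-relation x = ≡.trans (F≡G-Gᵒᵖ (- x) (x + 1ℚ)) (≡.trans (relation x 1ℚ) (≡.sym (F≡G-Gᵒᵖ x 1ℚ)))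

    vanishes : ∀ x → ∑[ i < suc M ] (coefficient (toℕ i) * x ^ toℕ i) ≡ 0ℚ
    vanishes x = begin
      S
        ≡⟨ solve 2 (λ s f → s := (s :+ f) :- f) ≡.refl S (F x 1ℚ) ⟩
      S + F x 1ℚ - F x 1ℚ
        ≡⟨ ≡.cong (_- F x 1ℚ) S+F≡F ⟩
      F (- x) (x + 1ℚ) - F x 1ℚ
        ≡⟨ ≡.cong (_- F x 1ℚ) (F-relation x) ⟩
      F x 1ℚ - F x 1ℚ
        ≡⟨ ℚ.+-inverseʳ (F x 1ℚ) ⟩
      0ℚ ∎
      where
      S = ∑[ i < suc M ] (coefficient (toℕ i) * x ^ toℕ i)
      S+F≡F : S + F x 1ℚ ≡ F (- x) (x + 1ℚ)
      S+F≡F = begin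
        S + F x 1ℚ
          ≡⟨ ≡.cong (S +_) (F[x,1] x) ⟩
        S + ∑[ n < suc M ] (binom M (toℕ n) * D (toℕ n) * x ^ toℕ n)
          ≡⟨ ∑-distrib-+ {suc M} (λ i → coefficient (toℕ i) * x ^ toℕ i) (λ n → binom M (toℕ n) * D (toℕ n) * x ^ toℕ n) ⟨
        ∑[ n < suc M ] (coefficient (toℕ n) * x ^ toℕ n + binom M (toℕ n) * D (toℕ n) * x ^ toℕ n)
          ≡⟨ (sum-cong-≗ {suc M} λ n → solve 4 (λ c t d p → c :* (t :- d) :* p :+ c :* d :* p := c :* t :* p)
               ≡.refl (binom M (toℕ n)) (transform (toℕ n)) (D (toℕ n)) (x ^ toℕ n)) ⟩
        ∑[ n < suc M ] (binom M (toℕ n) * transform (toℕ n) * x ^ toℕ n)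
          ≡⟨ F[-x,x+1] x ⟨
        F (- x) (x + 1ℚ) ∎

-- Folding even indices onto odd ones

-- Here and below L = K - 1, so that M = 2K - 1 is 2L + 1.
module EvenOddKernel (L : ℕ) (β : ℕ → ℚ) where

  private
    M : ℕ
    M = suc (L ℕ.* 2)

  open Antisymmetrisation M β
  open ≡.≡-Reasoning
  open +-*-Solver

  module _ (relation : PeriodRelation G) (endpoints : G 1ℚ 0ℚ ≡ G 0ℚ 1ℚ) where

    D[M]≡0 : D M ≡ 0ℚ
    D[M]≡0 = ≡.trans (D-antisymmetric {0} ℕ.z≤n) (≡.cong -_ (D[0]≡0 endpoints))

    -- The transform at 1 is D 0 - D 1, so being fixed forces 2 D 1 = D 0 = 0. This matches the
    -- first entry of the relation vector, which is 0 by definition.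
    D[1]≡0 : D 1 ≡ 0ℚ
    D[1]≡0 = *-zero-cancelˡ {2ℚ} {D 1} (λ ()) (begin
      2ℚ * D 1
        ≡⟨ solve 1 (λ d → con 2ℚ :* d := d :+ d) ≡.refl (D 1) ⟩
      D 1 + D 1
        ≡⟨ ≡.cong (D 1 +_) (transform-fixes-D relation {1} (ℕ.s≤s ℕ.z≤n)) ⟨
      D 1 + (1ℚ * 1ℚ * D 0 + (- 1ℚ * 1ℚ * 1ℚ * D 1 + ∑[ a < L ℕ.* 2 ] tail (toℕ a)))
        ≡⟨ ≡.cong₂ (λ d t → D 1 + (1ℚ * 1ℚ * d + (- 1ℚ * 1ℚ * 1ℚ * D 1 + t))) (D[0]≡0 endpoints)
             (∑-zero (L ℕ.* 2) (λ a → tail (toℕ a)) (λ a → tail≡0 (toℕ a))) ⟩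
      D 1 + (1ℚ * 1ℚ * 0ℚ + (- 1ℚ * 1ℚ * 1ℚ * D 1 + 0ℚ))
        ≡⟨ solve 1 (λ d → d :+ (con 1ℚ :* con 1ℚ :* con 0ℚ :+ (con (- 1ℚ) :* con 1ℚ :* con 1ℚ :* d :+ con 0ℚ)) := con 0ℚ)
             ≡.refl (D 1) ⟩
      0ℚ ∎)
      where
      tail : ℕ → ℚ
      tail a = -1^ (suc (suc a)) * binom 1 (suc (suc a)) * D (suc (suc a))
      tail≡0 : ∀ a → tail a ≡ 0ℚ
      tail≡0 a = ≡.trans
        (≡.cong (λ c → -1^ (suc (suc a)) * fromℕ c * D (suc (suc a))) (k>n⇒nCk≡0 {1} {suc (suc a)} (ℕ.s≤s (ℕ.s≤s ℕ.z≤n))))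
        (solve 2 (λ s d → s :* con 0ℚ :* d := con 0ℚ) ≡.refl (-1^ (suc (suc a))) (D (suc (suc a))))

    -- Row i = j + 1 and column n, so that K - i = L - j; the value j = L is the deleted row.
    -- Doubling is written `j ℕ.* 2` because this unfolds by two successors when j does.
    entry : ℕ → ℕ → ℚ
    entry n j = δ n (L ∸ j) - binom (n ℕ.* 2) ((L ∸ j) ℕ.* 2) - binom (n ℕ.* 2) (suc (j ℕ.* 2))

    odd-D∈kernel : ∀ {n} → n ℕ.≤ L → ∑[ j < L ] (D (suc (toℕ j ℕ.* 2)) * entry n (toℕ j)) ≡ 0ℚ
    odd-D∈kernel {n} n≤L = begin
      ∑[ j < L ] (v (toℕ j) * entry n (toℕ j))
        ≡⟨ ℚ.+-identityʳ (∑[ j < L ] (v (toℕ j) * entry n (toℕ j))) ⟨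
      ∑[ j < L ] (v (toℕ j) * entry n (toℕ j)) + 0ℚ
        -- The deleted row j = L is restored with weight D M = 0: reversal j -> L - j needs the full
        -- range from 0 to L.
        ≡⟨ ≡.cong (∑[ j < L ] (v (toℕ j) * entry n (toℕ j)) +_)
             (≡.trans (≡.cong (_* entry n L) D[M]≡0) (ℚ.*-zeroˡ (entry n L))) ⟨
      ∑[ j < L ] (v (toℕ j) * entry n (toℕ j)) + v L * entry n L
        ≡⟨ ∑-last L (λ j → v j * entry n j) ⟨
      ∑[ j < suc L ] (v (toℕ j) * entry n (toℕ j))
        ≡⟨ (sum-cong-≗ {suc L} λ j → solve 3 (λ v p q → v :* (p :- q) := v :* p :- v :* q) ≡.refl
             (v (toℕ j)) (δ n (L ∸ toℕ j) - binom (n ℕ.* 2) ((L ∸ toℕ j) ℕ.* 2)) (binom (n ℕ.* 2) (suc (toℕ j ℕ.* 2)))) ⟩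
      ∑[ j < suc L ] (even (toℕ j) + odd (toℕ j))
        ≡⟨ ∑-distrib-+ {suc L} (λ j → even (toℕ j)) (λ j → odd (toℕ j)) ⟩
      ∑[ j < suc L ] even (toℕ j) + ∑[ j < suc L ] odd (toℕ j)
        -- Only the part with δ and the even binomial is reversed; its odd weights D(2(L-j)+1)
        -- become -D(2j), while the odd binomials already carry the right index.
        ≡⟨ ≡.cong (_+ ∑[ j < suc L ] odd (toℕ j)) (∑-reverse L even) ⟩
      ∑[ j < suc L ] even (L ∸ toℕ j) + ∑[ j < suc L ] odd (toℕ j)
        ≡⟨ ∑-distrib-+ {suc L} (λ j → even (L ∸ toℕ j)) (λ j → odd (toℕ j)) ⟨
      ∑[ j < suc L ] (even (L ∸ toℕ j) + odd (toℕ j))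
        ≡⟨ (sum-cong-≗ {suc L} λ j → pair (ℕ.s≤s⁻¹ (Fin.toℕ<n j))) ⟩
      ∑[ j < suc L ] (δ n (toℕ j) * - D (toℕ j ℕ.* 2) + (f (toℕ j ℕ.* 2) + f (suc (toℕ j ℕ.* 2))))
        ≡⟨ ∑-distrib-+ {suc L} (λ j → δ n (toℕ j) * - D (toℕ j ℕ.* 2)) (λ j → f (toℕ j ℕ.* 2) + f (suc (toℕ j ℕ.* 2))) ⟩
      ∑[ j < suc L ] (δ n (toℕ j) * - D (toℕ j ℕ.* 2)) + ∑[ j < suc L ] (f (toℕ j ℕ.* 2) + f (suc (toℕ j ℕ.* 2)))
        ≡⟨ ≡.cong₂ _+_ (∑-δ {n} {suc L} (ℕ.s≤s n≤L) (λ j → - D (j ℕ.* 2))) (≡.sym (∑-pairs (suc L) f)) ⟩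
      - D (n ℕ.* 2) + transform (n ℕ.* 2)
        ≡⟨ ≡.cong (- D (n ℕ.* 2) +_) (transform-fixes-D relation (ℕ.m≤n⇒m≤1+n (ℕ.*-monoˡ-≤ 2 n≤L))) ⟩
      - D (n ℕ.* 2) + D (n ℕ.* 2)
        ≡⟨ ℚ.+-inverseˡ (D (n ℕ.* 2)) ⟩
      0ℚ ∎
      where
      v f even odd : ℕ → ℚ
      v j = D (suc (j ℕ.* 2))
      f a = -1^ a * binom (n ℕ.* 2) a * D a
      even j = v j * (δ n (L ∸ j) - binom (n ℕ.* 2) ((L ∸ j) ℕ.* 2))
      odd j = - (v j * binom (n ℕ.* 2) (suc (j ℕ.* 2)))

      v[L-j] : ∀ {j} → j ℕ.≤ L → v (L ∸ j) ≡ - D (j ℕ.* 2)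
      v[L-j] {j} j≤L = ≡.trans
        (≡.cong D (≡.trans (≡.cong suc (ℕ.*-distribʳ-∸ 2 L j)) (≡.sym (ℕ.+-∸-assoc 1 2j≤2L))))
        (D-antisymmetric (ℕ.m≤n⇒m≤1+n 2j≤2L))
        where
        2j≤2L : j ℕ.* 2 ℕ.≤ L ℕ.* 2
        2j≤2L = ℕ.*-monoˡ-≤ 2 j≤L

      -- The two minus signs on the even binomial cancel, and the one on the odd binomial is the
      -- sign (-1)ᵃ. So the binomials form two consecutive terms of `transform`, and δ leaves the
      -- value -D(2n) that the transform must cancel.
      pair : ∀ {j} → j ℕ.≤ L →
        even (L ∸ j) + odd j ≡ δ n j * - D (j ℕ.* 2) + (f (j ℕ.* 2) + f (suc (j ℕ.* 2)))
      pair {j} j≤L = begin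
        even (L ∸ j) + odd j
          ≡⟨ ≡.cong₂ (λ w i → w * (δ n i - binom (n ℕ.* 2) (i ℕ.* 2)) + odd j) (v[L-j] j≤L) (ℕ.m∸[m∸n]≡n j≤L) ⟩
        - D (j ℕ.* 2) * (δ n j - binom (n ℕ.* 2) (j ℕ.* 2)) + odd j
          ≡⟨ solve 5 (λ d e p w q → (:- d) :* (e :- p) :+ (:- (w :* q))
               := e :* (:- d) :+ (con 1ℚ :* p :* d :+ con (- 1ℚ) :* con 1ℚ :* q :* w)) ≡.refl
               (D (j ℕ.* 2)) (δ n j) (binom (n ℕ.* 2) (j ℕ.* 2)) (v j) (binom (n ℕ.* 2) (suc (j ℕ.* 2))) ⟩
        δ n j * - D (j ℕ.* 2) + (1ℚ * binom (n ℕ.* 2) (j ℕ.* 2) * D (j ℕ.* 2) + - 1ℚ * 1ℚ * binom (n ℕ.* 2) (suc (j ℕ.* 2)) * v j)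
          ≡⟨ ≡.cong (λ s → δ n j * - D (j ℕ.* 2) + (s * binom (n ℕ.* 2) (j ℕ.* 2) * D (j ℕ.* 2)
               + - 1ℚ * s * binom (n ℕ.* 2) (suc (j ℕ.* 2)) * v j)) (-1^[i*2]≡1 j) ⟨
        δ n j * - D (j ℕ.* 2) + (f (j ℕ.* 2) + f (suc (j ℕ.* 2))) ∎

-- Entries of the truncated matrix

δ-≢ : ∀ {m n} → m ≢ n → δ m n ≡ 0ℚ
δ-≢ {m} {n} m≢n = ≡.cong (λ b → if b then 1ℚ else 0ℚ) (dec-false (m ℕ.≟ n) m≢n)

-- k - 2m - 1 for m = K - i, read in the row indexed by j = i - 1.
2K∸2m∸1≡1+2j : ∀ {L j} → j ℕ.≤ L → 2 ℕ.* suc L ∸ 2 ℕ.* (L ∸ j) ∸ 1 ≡ suc (j ℕ.* 2)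
2K∸2m∸1≡1+2j {L} {j} j≤L = ≡.cong (_∸ 1) (begin
  2 ℕ.* suc L ∸ 2 ℕ.* (L ∸ j)         ≡⟨ ℕ.*-distribˡ-∸ 2 (suc L) (L ∸ j) ⟨
  2 ℕ.* (suc L ∸ (L ∸ j))             ≡⟨ ≡.cong (2 ℕ.*_) (ℕ.+-∸-assoc 1 (ℕ.m∸n≤m L j)) ⟩
  2 ℕ.* suc (L ∸ (L ∸ j))             ≡⟨ ≡.cong (λ i → 2 ℕ.* suc i) (ℕ.m∸[m∸n]≡n j≤L) ⟩
  2 ℕ.* suc j                         ≡⟨ ℕ.*-comm 2 (suc j) ⟩
  suc j ℕ.* 2                         ∎)
  where open ≡.≡-Reasoning

-- The remaining columns have n < K, so neither the factor -½ nor δ n K appears.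
𝓑¹-entry : ∀ L (j n : Fin L) → 𝓑¹ (suc L) j n ≡
  δ (suc (toℕ n)) (L ∸ toℕ j) - binom (suc (toℕ n) ℕ.* 2) ((L ∸ toℕ j) ℕ.* 2)
    - binom (suc (toℕ n) ℕ.* 2) (suc (toℕ j ℕ.* 2))
𝓑¹-entry L j n = begin
  row (toℕ (Fin.inject₁ j)) (toℕ (Fin.inject₁ n))
    ≡⟨ ≡.cong₂ row (Fin.toℕ-inject₁ j) (Fin.toℕ-inject₁ n) ⟩
  row (toℕ j) (toℕ n)
    ≡⟨ ≡.cong (λ b → if b then z * -½ else z) (dec-false (suc (toℕ n) ℕ.≟ suc L) 1+n≢1+L) ⟩
  δ n′ m + δ n′ (suc L) - binom (2 ℕ.* n′) (2 ℕ.* m) - binom (2 ℕ.* n′) (2 ℕ.* suc L ∸ 2 ℕ.* m ∸ 1)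
    ≡⟨ ≡.cong (λ d → d - binom (2 ℕ.* n′) (2 ℕ.* m) - binom (2 ℕ.* n′) (2 ℕ.* suc L ∸ 2 ℕ.* m ∸ 1))
         (≡.trans (≡.cong (δ n′ m +_) (δ-≢ 1+n≢1+L)) (ℚ.+-identityʳ (δ n′ m))) ⟩
  δ n′ m - binom (2 ℕ.* n′) (2 ℕ.* m) - binom (2 ℕ.* n′) (2 ℕ.* suc L ∸ 2 ℕ.* m ∸ 1)
    ≡⟨ ≡.cong₂ (λ b c → δ n′ m - binom b (2 ℕ.* m) - binom b c)
         (ℕ.*-comm 2 n′) (2K∸2m∸1≡1+2j (ℕ.<⇒≤ (Fin.toℕ<n j))) ⟩
  δ n′ m - binom (n′ ℕ.* 2) (2 ℕ.* m) - binom (n′ ℕ.* 2) (suc (toℕ j ℕ.* 2))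
    ≡⟨ ≡.cong (λ b → δ n′ m - binom (n′ ℕ.* 2) b - binom (n′ ℕ.* 2) (suc (toℕ j ℕ.* 2))) (ℕ.*-comm 2 m) ⟩
  δ n′ m - binom (n′ ℕ.* 2) (m ℕ.* 2) - binom (n′ ℕ.* 2) (suc (toℕ j ℕ.* 2)) ∎
  where
  open ≡.≡-Reasoning
  n′ = suc (toℕ n)
  m = L ∸ toℕ j
  z = zagier (suc L) m n′
  row : ℕ → ℕ → ℚ
  row j n = if does (suc n ℕ.≟ suc L) then zagier (suc L) (L ∸ j) (suc n) * -½ else zagier (suc L) (L ∸ j) (suc n)
  1+n≢1+L : suc (toℕ n) ≢ suc L
  1+n≢1+L = ℕ.<⇒≢ (ℕ.s≤s (Fin.toℕ<n n))

-- From relation coefficients to the left kernel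

module RelationVector (L : ℕ) (a : ℕ → ℕ → ℚ) where

  M : ℕ
  M = suc (L ℕ.* 2)

  -- The number `M` in the form used by `TypeI` and `TypeII`; `M` itself is in the form that
  -- computes.
  N : ℕ
  N = 2 ℕ.* suc L ∸ 1

  N≡M : N ≡ M
  N≡M = ≡.cong (_∸ 1) (ℕ.*-comm 2 (suc L))

  weight≡2+M : weight (suc L) ≡ suc (suc M)
  weight≡2+M = ≡.trans (ℕ.+-comm (2 ℕ.* suc L) 1) (≡.cong suc (ℕ.*-comm 2 (suc L)))

  -- With t = r - 1, M - t is s - 1, so reversing the index exchanges r and s. Even r correspond to
  -- odd t.
  β : ℕ → ℚ
  β t = a (suc t) (weight (suc L) ∸ suc t)

  open Antisymmetrisation M β
  open EvenOddKernel L β using (odd-D∈kernel; D[1]≡0)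

  D≡a-aᵒᵖ : ∀ {t} → t ℕ.≤ M → D t ≡ a (suc t) (weight (suc L) ∸ suc t) - a (weight (suc L) ∸ suc t) (suc t)
  D≡a-aᵒᵖ {t} t≤M = ≡.cong₂ (λ r s → β t - a r s) (≡.trans (≡.sym (ℕ.+-∸-assoc 1 t≤M)) (≡.cong (_∸ suc t) (≡.sym weight≡2+M)))
    (≡.trans (≡.cong₂ _∸_ weight≡2+M (≡.sym (ℕ.+-∸-assoc 1 t≤M)))
      (ℕ.m∸[m∸n]≡n {suc (suc M)} {suc t} (ℕ.s≤s (ℕ.m≤n⇒m≤1+n t≤M))))

  module _ (relation : PeriodRelation G) (endpoints : G 1ℚ 0ℚ ≡ G 0ℚ 1ℚ) where

    relationVector≡D : (j : Fin L) → relationVector (suc L) a j ≡ D (suc (toℕ j ℕ.* 2))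
    relationVector≡D zero    = ≡.sym (D[1]≡0 relation endpoints)
    relationVector≡D (suc j) = ≡.trans
      (≡.cong (λ r → a r (weight (suc L) ∸ r) - a (weight (suc L) ∸ r) r) (ℕ.*-comm 2 (2 ℕ.+ toℕ j)))
      (≡.sym (D≡a-aᵒᵖ (ℕ.s≤s (ℕ.*-monoˡ-≤ 2 (ℕ.<⇒≤ (Fin.toℕ<n (suc j)))))))

    relationVector∈kernel : relationVector (suc L) a ∈LeftKernel 𝓑¹ (suc L)
    relationVector∈kernel n = ≡.trans
      (sum-cong-≗ {L} λ j → ≡.cong₂ _*_ (relationVector≡D j) (𝓑¹-entry L j n))
      (odd-D∈kernel relation endpoints (Fin.toℕ<n n))

-- The two types of relations

PeriodRelation-cong : ∀ {G H} → (∀ x y → G x y ≡ H x y) → PeriodRelation G → PeriodRelation H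
PeriodRelation-cong G≡H relation x y = ≡.trans
  (≡.cong₂ _-_ (≡.sym (G≡H (- x) (x + y))) (≡.sym (G≡H (x + y) (- x))))
  (≡.trans (relation x y) (≡.cong₂ _-_ (G≡H x y) (G≡H y x)))

typeI∈kernel : ∀ L {w p b} → W⁺ w p → TypeI (suc L) p b → relationVector (suc L) b ∈LeftKernel 𝓑¹ (suc L)
typeI∈kernel L {w} {p} {b} p∈W⁺ (b[2K,1]≡0 , p[X+Y,Y]≈) =
  relationVector∈kernel (PeriodRelation-cong G≡ (W⁺-periodRelation p∈W⁺))
    (≡.trans (≡.sym (G≡ 1ℚ 0ℚ)) (≡.trans (W⁺-endpoints p∈W⁺) (G≡ 0ℚ 1ℚ)))
  where
  open RelationVector L b
  open Antisymmetrisation M β using (G)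
  open ≡.≡-Reasoning
  open +-*-Solver

  β[M]≡0 : β M ≡ 0ℚ
  β[M]≡0 = ≡.trans (≡.cong₂ b (ℕ.*-comm (suc L) 2)
    (≡.trans (≡.cong (_∸ suc M) weight≡2+M) (ℕ.m+n∸n≡m 1 (suc M)))) b[2K,1]≡0

  module _ (x y : ℚ) where

    term scaled : ℕ → ℚ
    term t = binom N t * b (suc t) (weight (suc L) ∸ suc t) * (x ^ t * y ^ (weight (suc L) ∸ suc t ∸ 2))
    scaled t = binom M t * β t * (x ^ t * y ^ (M ∸ t))

    -- For t < M one has s ≥ 2, so the truncated exponent s ∸ 2 is exact and one more factor y gives
    -- s - 1 = M - t.
    y*term≡scaled : ∀ {t} → t ℕ.< M → y * term t ≡ scaled t
    y*term≡scaled {t} t<M = begin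
      y * (binom N t * β t * (x ^ t * y ^ (weight (suc L) ∸ suc t ∸ 2)))
        ≡⟨ solve 5 (λ y c d p q → y :* (c :* d :* (p :* q)) := c :* d :* (p :* (y :* q)))
             ≡.refl y (binom N t) (β t) (x ^ t) (y ^ (weight (suc L) ∸ suc t ∸ 2)) ⟩
      binom N t * β t * (x ^ t * y ^ suc (weight (suc L) ∸ suc t ∸ 2))
        ≡⟨ ≡.cong₂ (λ n s → binom n t * β t * (x ^ t * y ^ s)) N≡M exponent ⟩
      scaled t ∎
      where
      exponent : suc (weight (suc L) ∸ suc t ∸ 2) ≡ M ∸ t
      exponent = begin
        suc (weight (suc L) ∸ suc t ∸ 2)   ≡⟨ ≡.cong (λ k → suc (k ∸ suc t ∸ 2)) weight≡2+M ⟩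
        suc (suc M ∸ t ∸ 2)                ≡⟨ ≡.cong (λ k → suc (k ∸ 2)) (ℕ.+-∸-assoc 1 (ℕ.<⇒≤ t<M)) ⟩
        suc (M ∸ t ∸ 1)                    ≡⟨ ℕ.m+[n∸m]≡n (ℕ.m<n⇒0<n∸m t<M) ⟩
        M ∸ t                              ∎

    G≡ : y * eval p (x + y) y ≡ G x y
    G≡ = begin
      y * eval p (x + y) y
        ≡⟨ ≡.cong (y *_) (ℚ-Evaluation.eval-shift p x y) ⟨
      y * eval (p ⟨ X ⊕ Y , Y ⟩) x y
        ≡⟨ ≡.cong (y *_) (ℚ-Evaluation.⟦⟧-cong (p ⟨ X ⊕ Y , Y ⟩) (map polyTerm (upTo N)) p[X+Y,Y]≈ (monomial x y)) ⟩
      y * eval (map polyTerm (upTo N)) x y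
        ≡⟨ ≡.cong (y *_) (ℚ-Evaluation.⟦⟧-upTo polyTerm (monomial x y) N) ⟩
      y * ∑[ t < N ] term (toℕ t)
        ≡⟨ ≡.cong (λ n → y * ∑[ t < n ] term (toℕ t)) N≡M ⟩
      y * ∑[ t < M ] term (toℕ t)
        ≡⟨ *-distribˡ-sum {M} y (λ t → term (toℕ t)) ⟩
      ∑[ t < M ] (y * term (toℕ t))
        ≡⟨ (sum-cong-≗ {M} λ t → y*term≡scaled (Fin.toℕ<n t)) ⟩
      ∑[ t < M ] scaled (toℕ t)
        -- Type I has M terms and `G` has M + 1. The missing one, t = M, belongs to (r , s) = (2K ,
        -- 1), where b vanishes.
        ≡⟨ ℚ.+-identityʳ (∑[ t < M ] scaled (toℕ t)) ⟨
      ∑[ t < M ] scaled (toℕ t) + 0ℚ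
        ≡⟨ ≡.cong (∑[ t < M ] scaled (toℕ t) +_) scaled[M]≡0 ⟨
      ∑[ t < M ] scaled (toℕ t) + scaled M
        ≡⟨ ∑-last M scaled ⟨
      G x y ∎
      where
      polyTerm : ℕ → Term
      polyTerm t = (binom N t * b (suc t) (weight (suc L) ∸ suc t)) X^ t Y^ (weight (suc L) ∸ suc t ∸ 2)
      scaled[M]≡0 : scaled M ≡ 0ℚ
      scaled[M]≡0 = ≡.trans (≡.cong (λ z → binom M M * z * (x ^ M * y ^ (M ∸ M))) β[M]≡0)
        (solve 2 (λ c z → c :* con 0ℚ :* z := con 0ℚ) ≡.refl (binom M M) (x ^ M * y ^ (M ∸ M)))

typeII∈kernel : ∀ L {w p c} → W⁻ w p → TypeII (suc L) p c → relationVector (suc L) c ∈LeftKernel 𝓑¹ (suc L)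
typeII∈kernel L {w} {p} {c} p∈W⁻ ∂Xp[X+Y,Y]≈ =
  relationVector∈kernel (PeriodRelation-cong G≡ (W⁻-periodRelation p∈W⁻))
    (≡.trans (≡.sym (G≡ 1ℚ 0ℚ)) (≡.trans (W⁻-endpoints p∈W⁻) (G≡ 0ℚ 1ℚ)))
  where
  open RelationVector L c
  open Antisymmetrisation M β using (G)
  open ≡.≡-Reasoning

  module _ (x y : ℚ) where

    term : ℕ → ℚ
    term t = binom N t * β t * (x ^ t * y ^ (weight (suc L) ∸ suc t ∸ 1))

    exponent : ∀ {t} → t ℕ.≤ M → weight (suc L) ∸ suc t ∸ 1 ≡ M ∸ t
    exponent {t} t≤M = ≡.trans (≡.cong (λ k → k ∸ suc t ∸ 1) weight≡2+M) (≡.cong (_∸ 1) (ℕ.+-∸-assoc 1 t≤M))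

    G≡ : eval (∂X p) (x + y) y ≡ G x y
    G≡ = begin
      eval (∂X p) (x + y) y
        ≡⟨ eval-∂X-shift p x y ⟨
      eval (∂X (p ⟨ X ⊕ Y , Y ⟩)) x y
        ≡⟨ ℚ-Evaluation.⟦⟧-cong (∂X (p ⟨ X ⊕ Y , Y ⟩)) (map polyTerm (upTo (2 ℕ.* suc L))) ∂Xp[X+Y,Y]≈ (monomial x y) ⟩
      eval (map polyTerm (upTo (2 ℕ.* suc L))) x y
        ≡⟨ ℚ-Evaluation.⟦⟧-upTo polyTerm (monomial x y) (2 ℕ.* suc L) ⟩
      ∑[ t < 2 ℕ.* suc L ] term (toℕ t)
        ≡⟨ ≡.cong (λ n → ∑[ t < n ] term (toℕ t)) (ℕ.*-comm 2 (suc L)) ⟩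
      ∑[ t < suc M ] term (toℕ t)
        ≡⟨ (sum-cong-≗ {suc M} λ t → ≡.cong₂ (λ n s → binom n (toℕ t) * β (toℕ t) * (x ^ toℕ t * y ^ s))
             N≡M (exponent (ℕ.s≤s⁻¹ (Fin.toℕ<n t)))) ⟩
      G x y ∎
      where
      polyTerm : ℕ → Term
      polyTerm t = (binom N t * c (suc t) (weight (suc L) ∸ suc t)) X^ t Y^ (weight (suc L) ∸ suc t ∸ 1)

proposition13 : (K : ℕ) →
    (12 ℕ.≤ 2 ℕ.* K → (p : Poly) → W⁺ (2 ℕ.* K) p →
      (b : ℕ → ℕ → ℚ) → TypeI K p b →
      relationVector K b ∈LeftKernel 𝓑¹ K)
  × (12 ℕ.≤ 2 ℕ.* K ℕ.+ 2 → (p : Poly) → W⁻ (2 ℕ.* K ℕ.+ 2) p →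
      (c : ℕ → ℕ → ℚ) → TypeII K p c →
      relationVector K c ∈LeftKernel 𝓑¹ K)
proposition13 zero    = (λ _ _ _ _ _ ()) , (λ _ _ _ _ _ ())
proposition13 (suc L) =
  (λ _ p p∈W⁺ b typeI → typeI∈kernel L {2 ℕ.* suc L} {p} p∈W⁺ typeI) ,
  (λ _ p p∈W⁻ c typeII → typeII∈kernel L {2 ℕ.* suc L ℕ.+ 2} {p} p∈W⁻ typeII)
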